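{- Let $T_1$ and $T_2$ be trees, $T_2$ having at least two vertices, with $6\le n=|V(T_1)|\ge |V(T_2)|$. Then $R(B^3T_1,B^3T_2)=n$.
   Context: A 3-uniform hypergraph consists of a vertex set and a set of 3-element subsets (hyperedges); $\mathcal{K}_N^3$ is the complete 3-uniform hypergraph on $N$ vertices. A 3-uniform hypergraph $\mathcal{H}$ contains a Berge-$F$ (for a graph $F$) if there are an injection $\varphi:V(F)\to V(\mathcal{H})$ and an injection $f$ from $E(F)$ to the hyperedges of $\mathcal{H}$ with $\{\varphi(x),\varphi(y)\}\subseteq f(xy)$ for every edge $xy$. $R(B^3T_1,B^3T_2)$ is the smallest $N$ such that for every coloring of the hyperedges of $\mathcal{K}_N^3$ with blue and red, the blue hyperedges contain a Berge-$T_1$ or the red hyperedges contain a Berge-$T_2$. -}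

module Defs where

open import Data.Nat using (ℕ; zero; suc; _≥_)
open import Data.Fin using (Fin; zero; suc; inject₁; fromℕ; _<_)
open import Data.Fin.Subset using (Subset; _∈_; ∣_∣)
open import Data.Product using (Σ; Σ-syntax; _×_; _,_; proj₁; proj₂)
open import Data.Sum using (_⊎_)
open import Function.Definitions using (Injective)
open import Relation.Binary.PropositionalEquality using (_≡_)
open import Relation.Binary.Construct.Closure.ReflexiveTransitive using (Star)
open import Relation.Nullary using (¬_)

record Graph (m : ℕ) : Set₁ where
  field
    Adj   : Fin m → Fin m → Set
    sym   : ∀ {x y} → Adj x y → Adj y x
    irrefl : ∀ {x} → ¬ Adj x x
open Graph public

Edge : ∀ {m} → Graph m → Set
Edge {m} G = Σ (Fin m × Fin m) λ p → (proj₁ p < proj₂ p) × Adj G (proj₁ p) (proj₂ p)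

Connected : ∀ {m} → Graph m → Set
Connected {m} G = ∀ (x y : Fin m) → Star (Adj G) x y

record Cycle {m : ℕ} (G : Graph m) : Set where
  field
    k     : ℕ
    c     : Fin (suc (suc (suc k))) → Fin m
    inj   : Injective _≡_ _≡_ c
    step  : ∀ (i : Fin (suc (suc k))) → Adj G (c (inject₁ i)) (c (suc i))
    close : Adj G (c (fromℕ (suc (suc k)))) (c zero)

Acyclic : ∀ {m} → Graph m → Set
Acyclic G = ¬ Cycle G

IsTree : ∀ {m} → Graph m → Set
IsTree {m} G = (m ≥ 1) × Connected G × Acyclic G

data Colour : Set where
  blue red : Colour

-- A red/blue colouring of the hyperedges of the complete 3-uniform
-- hypergraph on Fin N; hyperedges are the 3-element subsets of Fin N
-- (values on other subsets are irrelevant).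
Colouring : ℕ → Set
Colouring N = Subset N → Colour

HyperedgeOf : ∀ {N} → Colouring N → Colour → Subset N → Set
HyperedgeOf χ col s = (∣ s ∣ ≡ 3) × (χ s ≡ col)

BergeIn : ∀ {N m} → Colouring N → Colour → Graph m → Set
BergeIn {N} {m} χ col G =
  Σ[ φ ∈ (Fin m → Fin N) ] Injective _≡_ _≡_ φ ×
  Σ[ f ∈ (Edge G → Subset N) ]
    (∀ e → HyperedgeOf χ col (f e)) ×
    (∀ e → (φ (proj₁ (proj₁ e)) ∈ f e) × (φ (proj₂ (proj₁ e)) ∈ f e)) ×
    (∀ e e′ → f e ≡ f e′ → proj₁ e ≡ proj₁ e′)

RamseyProp : ∀ {m₁ m₂} → Graph m₁ → Graph m₂ → ℕ → Set
RamseyProp T₁ T₂ N = ∀ (χ : Colouring N) → BergeIn χ blue T₁ ⊎ BergeIn χ red T₂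

BergeRamseyIs : ∀ {m₁ m₂} → Graph m₁ → Graph m₂ → ℕ → Set
BergeRamseyIs T₁ T₂ r = RamseyProp T₁ T₂ r × (∀ N → N Data.Nat.< r → ¬ RamseyProp T₁ T₂ N)

{-# OPTIONS --safe #-}
module Submission where

-- Call a pair of vertices pure if all triples containing it have the same colour. If a vertex v
-- lies in no pure pair, a leaf can always be attached at v to a tree found on the other vertices,
-- so by induction every vertex may be assumed to lie in a pure pair; by colour, this splits the
-- vertices into two classes, and pure pairs of different colours are disjoint.
--
-- If every edge of an embedded tree lies in two triples of a colour, the edges can be assigned
-- distinct triples, because a triple contains at most two edges of a tree. When each vertex of the
-- larger class, red say, has two pure partners, this applies to any embedding of T₂ that puts the
-- smaller class into an independent set of positions, for instance into a part of the bipartition.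
-- A vertex with only one pure partner is rare: two of them without a common partner can be removed,
-- and the trees found on the remaining vertices extend by two leaves with different parents. If all
-- such vertices have the same partner, a variant of the embedding works.
--
-- Stars have no such leaves and are treated separately. The induction starts with five vertices,
-- where only the case of two stars fails; this case, two stars on six vertices, and the existence
-- of all non-stars among the triples that contain a pure pair on six and seven vertices are
-- finite computations.

open import Defs hiding (sym)
open import Data.Nat using (ℕ; _≤_; _≥_)
open import Data.Nat as ℕ using (zero; suc; _≤ᵇ_; _≡ᵇ_)
import Data.Nat.Properties as ℕ
open import Data.Nat.ListAction using (sum)
open import Data.Bool as Bool using (Bool; true; false; _∧_; _∨_; if_then_else_; not)
open import Data.Bool.Properties using (∧-identityʳ; not-involutive)
open import Data.List as List using (List; []; _∷_; concatMap; allFin; filterᵇ)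
open import Data.List.Relation.Unary.All using (All; []; _∷_)
open import Data.Maybe using (Maybe; just; nothing; is-just)
open import Data.Vec using (Vec; []; _∷_; lookup; tabulate; _[_]≔_; here; there)
open import Data.Vec.Properties using (lookup∘tabulate; []≔-commutes; []≔-updates; []≔-minimal)
open import Data.Vec.Functional using (insertAt)
open import Data.Vec.Functional.Properties using (insertAt-lookup; insertAt-punchIn)
open import Data.Fin as Fin
  using (Fin; zero; suc; toℕ; inject₁; punchIn; punchOut; fromℕ; opposite; #_)
open import Data.Fin.Properties
  using (_≟_; any?; all?; suc-injective; inject₁-injective; toℕ-inject₁; toℕ-injective; pigeonhole;
         punchIn-injective; punchInᵢ≢i; punchIn-punchOut; punchOut-injective; opposite-involutive;
         injective⇒≤)
open import Data.Fin.Subset using (Subset; inside; _∈_; ∣_∣) renaming (⊥ to ∅)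
open import Data.Fin.Subset.Properties using (∉⊥; ∣⊥∣≡0)
open import Data.Product using (Σ-syntax; ∃; ∃₂; _×_; _,_; proj₁; proj₂)
open import Data.Product.Properties using (≡-dec)
open import Data.Sum as Sum using (_⊎_; inj₁; inj₂; [_,_]′)
open import Data.Empty using (⊥; ⊥-elim)
open import Function using (_∘_; id; case_of_)
open import Relation.Nullary using (¬_; Dec; yes; no; does)
open import Relation.Nullary.Decidable using (_×-dec_; _⊎-dec_; _→-dec_; ¬?; from-yes)
open import Relation.Binary.Construct.Closure.ReflexiveTransitive using (Star; ε; _◅_)
open import Relation.Binary.Definitions using (DecidableEquality; tri<; tri≈; tri>)
open import Relation.Binary.PropositionalEquality
  using (_≡_; _≢_; refl; sym; trans; cong; cong₂; subst; subst₂; ≢-sym)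
open import Algebra.Properties.CommutativeSemigroup ℕ.+-commutativeSemigroup using (x∙yz≈y∙xz)

-- The trees span the vertex set, so the third vertex of every triple is again a tree vertex and two
-- edges may compete for the same triple; this is the main obstacle. A leaf attached at a vertex v
-- that occurs in no earlier triple brings a new triple automatically, so it fails only if every
-- triple containing v and the intended parent has the other colour: this is where pure pairs come
-- from. Pure pairs of different colours cannot meet, because a common triple would need both
-- colours.
--
-- The bound six comes from stars: on five vertices, the five triples of consecutive elements modulo
-- 5 and the five other triples each cover every vertex three times, while the centre of a star with
-- four edges needs four triples. On four vertices a tree needs three of the four triples, and each
-- colour may have two.

-- Trees grown leaf by leaf

-- A tree with k edges, grown from its root by attaching leaves. The vertex attached last is
-- zero, so that every vertex except the root has a parent with a larger index.
data Tree : ℕ → Set where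
  root : Tree 0
  leaf : ∀ {k} → Tree k → Fin (suc k) → Tree (suc k)

-- The edge j joins the vertex inject₁ j to its parent.
par : ∀ {k} → Tree k → Fin k → Fin (suc k)
par (leaf T p) zero    = suc p
par (leaf T p) (suc j) = suc (par T j)

par> : ∀ {k} (T : Tree k) j → toℕ j ℕ.< toℕ (par T j)
par> (leaf T p) zero    = ℕ.s≤s ℕ.z≤n
par> (leaf T p) (suc j) = ℕ.s≤s (par> T j)

Join : ∀ {k} → Tree k → Fin k → Fin (suc k) → Fin (suc k) → Set
Join T j x y = (x ≡ inject₁ j × y ≡ par T j) ⊎ (y ≡ inject₁ j × x ≡ par T j)

Joined : ∀ {k} → Tree k → Fin (suc k) → Fin (suc k) → Set
Joined T x y = ∃ λ j → Join T j x y

Joined-sym : ∀ {k} {T : Tree k} {x y} → Joined T x y → Joined T y x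
Joined-sym (j , e) = j , Sum.swap e

Joined-par : ∀ {k} (T : Tree k) j → Joined T (inject₁ j) (par T j)
Joined-par T j = j , inj₁ (refl , refl)

Joined-leaf : ∀ {k} {T : Tree k} {p x y} → Joined T x y → Joined (leaf T p) (suc x) (suc y)
Joined-leaf (j , inj₁ (a , b)) = suc j , inj₁ (cong suc a , cong suc b)
Joined-leaf (j , inj₂ (a , b)) = suc j , inj₂ (cong suc a , cong suc b)

Joined-new : ∀ {k} {T : Tree k} {p} → Joined (leaf T p) zero (suc p)
Joined-new = zero , inj₁ (refl , refl)

inject₁≢par : ∀ {k} (T : Tree k) j → inject₁ j ≢ par T j
inject₁≢par T j eq = ℕ.<-irrefl (trans (sym (toℕ-inject₁ j)) (cong toℕ eq)) (par> T j)

Join-unique : ∀ {k} (T : Tree k) {i j x y} → Join T i x y → Join T j x y → i ≡ j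
Join-unique T (inj₁ (a , b)) (inj₁ (c , d)) = inject₁-injective (trans (sym a) c)
Join-unique T (inj₂ (a , b)) (inj₂ (c , d)) = inject₁-injective (trans (sym a) c)
Join-unique T {i} {j} (inj₁ (a , b)) (inj₂ (c , d)) = ⊥-elim (ℕ.<-asym
  (subst (toℕ i ℕ.<_) (trans (cong toℕ (trans (sym b) c)) (toℕ-inject₁ j)) (par> T i))
  (subst (toℕ j ℕ.<_) (trans (cong toℕ (trans (sym d) a)) (toℕ-inject₁ i)) (par> T j)))
Join-unique T {i} {j} (inj₂ (a , b)) (inj₁ (c , d)) = ⊥-elim (ℕ.<-asym
  (subst (toℕ i ℕ.<_) (trans (cong toℕ (trans (sym b) c)) (toℕ-inject₁ j)) (par> T i))
  (subst (toℕ j ℕ.<_) (trans (cong toℕ (trans (sym d) a)) (toℕ-inject₁ i)) (par> T j)))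

-- Triples up to order

Tri : Set → Set
Tri A = A × A × A

infix 4 _∈₃_ _⊆₃_ _≈₃_

_∈₃_ : {A : Set} → A → Tri A → Set
w ∈₃ (x , y , z) = w ≡ x ⊎ w ≡ y ⊎ w ≡ z

_⊆₃_ : {A : Set} → Tri A → Tri A → Set
(x , y , z) ⊆₃ t = x ∈₃ t × y ∈₃ t × z ∈₃ t

_≈₃_ : {A : Set} → Tri A → Tri A → Set
s ≈₃ t = s ⊆₃ t × t ⊆₃ s

pattern 1st e = inj₁ e
pattern 2nd e = inj₂ (inj₁ e)
pattern 3rd e = inj₂ (inj₂ e)

∈₃-⊆₃ : {A : Set} {w : A} {s t : Tri A} → w ∈₃ s → s ⊆₃ t → w ∈₃ t
∈₃-⊆₃ (1st refl) (a , b , c) = a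
∈₃-⊆₃ (2nd refl) (a , b , c) = b
∈₃-⊆₃ (3rd refl) (a , b , c) = c

⊆₃-trans : {A : Set} {s t u : Tri A} → s ⊆₃ t → t ⊆₃ u → s ⊆₃ u
⊆₃-trans (a , b , c) q = ∈₃-⊆₃ a q , ∈₃-⊆₃ b q , ∈₃-⊆₃ c q

≈₃-trans : {A : Set} {s t u : Tri A} → s ≈₃ t → t ≈₃ u → s ≈₃ u
≈₃-trans (a , b) (c , d) = ⊆₃-trans a c , ⊆₃-trans d b

≈₃-sym : {A : Set} {s t : Tri A} → s ≈₃ t → t ≈₃ s
≈₃-sym (a , b) = b , a

⊆₃-cancel : {A B : Set} {f : A → B} → (∀ {x y} → f x ≡ f y → x ≡ y) → ∀ {x y z a b c} →
            (f x , f y , f z) ⊆₃ (f a , f b , f c) → (x , y , z) ⊆₃ (a , b , c)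
⊆₃-cancel inj (p , q , r) = Sum.map inj (Sum.map inj inj) p , Sum.map inj (Sum.map inj inj) q
                          , Sum.map inj (Sum.map inj inj) r

swap₁₂-⊆ : {A : Set} {x y z : A} → (x , y , z) ⊆₃ (y , x , z)
swap₁₂-⊆ = 2nd refl , 1st refl , 3rd refl

swap₁₂ : {A : Set} {x y z : A} → (x , y , z) ≈₃ (y , x , z)
swap₁₂ = swap₁₂-⊆ , swap₁₂-⊆

index₃ : {A : Set} {w : A} {t : Tri A} → w ∈₃ t → Fin 3
index₃ (1st _) = zero
index₃ (2nd _) = suc zero
index₃ (3rd _) = suc (suc zero)

index₃-injective : {A : Set} {v w : A} {t : Tri A} (p : v ∈₃ t) (q : w ∈₃ t) → index₃ p ≡ index₃ q → v ≡ w
index₃-injective (1st a) (1st b) e = trans a (sym b)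
index₃-injective (2nd a) (2nd b) e = trans a (sym b)
index₃-injective (3rd a) (3rd b) e = trans a (sym b)
index₃-injective (1st _) (2nd _) ()
index₃-injective (1st _) (3rd _) ()

pigeonhole₃ : {A : Set} {t : Tri A} (w : Fin 4 → A) → (∀ i → w i ∈₃ t) → ∃ λ i → ∃ λ j → i Fin.< j × w i ≡ w j
pigeonhole₃ w w∈ with pigeonhole ℕ.≤-refl (λ i → index₃ (w∈ i))
... | i , j , i<j , e = i , j , i<j , index₃-injective (w∈ i) (w∈ j) e

four-in-triple : {A : Set} {t : Tri A} {a b c d : A} → a ∈₃ t → b ∈₃ t → c ∈₃ t → d ∈₃ t →
                 a ≢ b → a ≢ c → a ≢ d → b ≢ c → b ≢ d → c ≢ d → ⊥
four-in-triple {A} {t} {a} {b} {c} {d} pa pb pc pd ab ac ad bc bd cd with pigeonhole₃ w w∈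
  where
  w : Fin 4 → A
  w zero = a
  w (suc zero) = b
  w (suc (suc zero)) = c
  w (suc (suc (suc zero))) = d
  w∈ : ∀ i → w i ∈₃ t
  w∈ zero = pa
  w∈ (suc zero) = pb
  w∈ (suc (suc zero)) = pc
  w∈ (suc (suc (suc zero))) = pd
... | zero , suc zero , _ , e = ab e
... | zero , suc (suc zero) , _ , e = ac e
... | zero , suc (suc (suc zero)) , _ , e = ad e
... | suc zero , suc (suc zero) , _ , e = bc e
... | suc zero , suc (suc (suc zero)) , _ , e = bd e
... | suc (suc zero) , suc (suc (suc zero)) , _ , e = cd e
... | suc zero , suc zero , ℕ.s≤s () , _
... | suc (suc zero) , suc zero , ℕ.s≤s () , _
... | suc (suc zero) , suc (suc zero) , ℕ.s≤s (ℕ.s≤s ()) , _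
... | suc (suc (suc zero)) , suc zero , ℕ.s≤s () , _
... | suc (suc (suc zero)) , suc (suc zero) , ℕ.s≤s (ℕ.s≤s ()) , _
... | suc (suc (suc zero)) , suc (suc (suc zero)) , ℕ.s≤s (ℕ.s≤s (ℕ.s≤s ())) , _

-- Colourings and Berge copies of trees

-- χ x y z is the colour of {x , y , z}; the values for coinciding arguments are irrelevant.
Col : ℕ → Set
Col N = Fin N → Fin N → Fin N → Colour

record Symmetric {N} (χ : Col N) : Set where
  field
    swap₁ : ∀ x y z → χ x y z ≡ χ y x z
    swap₂ : ∀ x y z → χ x y z ≡ χ x z y

  rot : ∀ x y z → χ x y z ≡ χ y z x
  rot x y z = trans (swap₁ x y z) (swap₂ y x z)

open Symmetric

_∘₃_ : ∀ {M N} → Col N → (Fin M → Fin N) → Col M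
(χ ∘₃ ι) x y z = χ (ι x) (ι y) (ι z)

∘₃-symmetric : ∀ {M N} {χ : Col N} (ι : Fin M → Fin N) → Symmetric χ → Symmetric (χ ∘₃ ι)
∘₃-symmetric ι s = record { swap₁ = λ x y z → swap₁ s _ _ _ ; swap₂ = λ x y z → swap₂ s _ _ _ }

-- A hyperedge consists of the two ends of its edge and one more vertex, so only that vertex is
-- stored. `distinct` is the injectivity of the map from edges to hyperedges.
record Berge {N k} (χ : Col N) (c : Colour) (T : Tree k) : Set where
  field
    φ     : Fin (suc k) → Fin N
    φ-inj : ∀ {i j} → φ i ≡ φ j → i ≡ j
    third : Fin k → Fin N

  tri : Fin k → Tri (Fin N)
  tri j = φ (inject₁ j) , φ (par T j) , third j

  field
    third≢child  : ∀ j → third j ≢ φ (inject₁ j)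
    third≢parent : ∀ j → third j ≢ φ (par T j)
    colour       : ∀ j → χ (φ (inject₁ j)) (φ (par T j)) (third j) ≡ c
    distinct     : ∀ {i j} → tri i ≈₃ tri j → i ≡ j

open Berge

Third : ∀ {N} → Col N → Colour → Fin N → Fin N → Fin N → Set
Third χ c x y z = z ≢ x × z ≢ y × χ x y z ≡ c

module _ {N : ℕ} {χ : Col N} {c : Colour} where

  addLeaf : ∀ {k} {T : Tree k} (B : Berge χ c T) p v z → (∀ i → φ B i ≢ v) → Third χ c v (φ B p) z →
            (∀ j → ¬ (v , φ B p , z) ≈₃ tri B j) → Berge χ c (leaf T p)
  addLeaf {k} {T} B p v z new (z≢v , z≢p , zc) fresh = record
    { φ = φ′ ; φ-inj = λ {i} {j} → φ′-inj i j ; third = third′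
    ; third≢child = λ { zero → z≢v ; (suc j) → third≢child B j }
    ; third≢parent = λ { zero → z≢p ; (suc j) → third≢parent B j }
    ; colour = λ { zero → zc ; (suc j) → colour B j }
    ; distinct = λ {i} {j} → distinct′ i j }
    where
    φ′ : Fin (suc (suc k)) → Fin N
    φ′ zero    = v
    φ′ (suc i) = φ B i
    φ′-inj : ∀ i j → φ′ i ≡ φ′ j → i ≡ j
    φ′-inj zero    zero    e = refl
    φ′-inj zero    (suc j) e = ⊥-elim (new j (sym e))
    φ′-inj (suc i) zero    e = ⊥-elim (new i e)
    φ′-inj (suc i) (suc j) e = cong suc (φ-inj B e)
    third′ : Fin (suc k) → Fin N
    third′ zero    = z
    third′ (suc j) = third B j
    distinct′ : ∀ i j → (φ′ (inject₁ i) , φ′ (par (leaf T p) i) , third′ i)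
                     ≈₃ (φ′ (inject₁ j) , φ′ (par (leaf T p) j) , third′ j) → i ≡ j
    distinct′ zero    zero    e = refl
    distinct′ zero    (suc j) e = ⊥-elim (fresh j e)
    distinct′ (suc i) zero    e = ⊥-elim (fresh i (≈₃-sym e))
    distinct′ (suc i) (suc j) e = cong suc (distinct B e)

  Avoids : ∀ {k} {T : Tree k} → Berge χ c T → Fin N → Set
  Avoids B v = (∀ i → φ B i ≢ v) × (∀ j → third B j ≢ v)

  -- The new triple contains `v`, which occurs in none of the old ones.
  addNew : ∀ {k} {T : Tree k} (B : Berge χ c T) p {v z} → Avoids B v → Third χ c v (φ B p) z →
           Berge χ c (leaf T p)
  addNew B p (a , b) t = addLeaf B p _ _ a t λ
    { j ((1st e , _) , _) → a _ (sym e) ; j ((2nd e , _) , _) → a _ (sym e) ; j ((3rd e , _) , _) → b _ (sym e) }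

  forgetLeaf : ∀ {k} {T : Tree k} {p} → Berge χ c (leaf T p) → Berge χ c T
  forgetLeaf B = record
    { φ = φ B ∘ suc ; φ-inj = suc-injective ∘ φ-inj B ; third = third B ∘ suc
    ; third≢child = third≢child B ∘ suc ; third≢parent = third≢parent B ∘ suc ; colour = colour B ∘ suc
    ; distinct = suc-injective ∘ distinct B }

  relabel : ∀ {M k} {T : Tree k} {ι : Fin M → Fin N} → (∀ {x y} → ι x ≡ ι y → x ≡ y) →
            Berge (χ ∘₃ ι) c T → Berge χ c T
  relabel {ι = ι} ι-inj B = record
    { φ = ι ∘ φ B ; φ-inj = φ-inj B ∘ ι-inj ; third = ι ∘ third B
    ; third≢child = λ j → third≢child B j ∘ ι-inj ; third≢parent = λ j → third≢parent B j ∘ ι-inj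
    ; colour = colour B ; distinct = λ (p , q) → distinct B (⊆₃-cancel ι-inj p , ⊆₃-cancel ι-inj q) }

  relabel-avoids : ∀ {M k} {T : Tree k} {ι : Fin M → Fin N} (inj : ∀ {x y} → ι x ≡ ι y → x ≡ y)
                   (B : Berge (χ ∘₃ ι) c T) {v} → (∀ x → ι x ≢ v) → Avoids (relabel inj B) v
  relabel-avoids inj B ι≢v = (λ i → ι≢v _) , (λ j → ι≢v _)

  -- Two new vertices a and b at distinct old vertices: the triples differ because together they
  -- contain a, b and both attachment points.
  addTwo : ∀ {k} {T : Tree k} (B : Berge χ c T) {p q} {a b z z′} → Avoids B a → Avoids B b → a ≢ b → p ≢ q →
           Third χ c a (φ B p) z → Third χ c b (φ B q) z′ → Berge χ c (leaf (leaf T p) (suc q))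
  addTwo B {p} {q} {a} {b} {z} {z′} a∉ b∉ a≢b p≢q ta tb =
    addLeaf B₁ (suc q) b z′
      (λ { zero → a≢b ; (suc i) → proj₁ b∉ i }) tb fresh
    where
    B₁ = addNew B p a∉ ta
    fresh : ∀ j → ¬ (b , φ B q , z′) ≈₃ tri B₁ j
    fresh zero    ((x , y , _) , _) = four-in-triple {t = a , φ B p , z} (1st refl) (2nd refl) x y
      (proj₁ a∉ p ∘ sym) a≢b (proj₁ a∉ q ∘ sym) (proj₁ b∉ p) (p≢q ∘ φ-inj B) (proj₁ b∉ q ∘ sym)
    fresh (suc j) ((1st e , _) , _) = proj₁ b∉ _ (sym e)
    fresh (suc j) ((2nd e , _) , _) = proj₁ b∉ _ (sym e)
    fresh (suc j) ((3rd e , _) , _) = proj₂ b∉ _ (sym e)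

-- Embeddings between trees

infix 4 _⊑_

-- In the applications both trees have the same size, so that this is an isomorphism between two
-- ways of growing one tree.
record _⊑_ {k l} (T : Tree k) (T′ : Tree l) : Set where
  field
    ψ      : Fin (suc k) → Fin (suc l)
    ψ-inj  : ∀ {x y} → ψ x ≡ ψ y → x ≡ y
    ψ-edge : ∀ j → Joined T′ (ψ (inject₁ j)) (ψ (par T j))

open _⊑_

ψ-joined : ∀ {k l} {T : Tree k} {T′ : Tree l} (s : T ⊑ T′) {x y} → Joined T x y → Joined T′ (ψ s x) (ψ s y)
ψ-joined s (j , inj₁ (refl , refl)) = ψ-edge s j
ψ-joined s (j , inj₂ (refl , refl)) = Joined-sym (ψ-edge s j)

⊑-refl : ∀ {k} {T : Tree k} → T ⊑ T
⊑-refl {T = T} = record { ψ = id ; ψ-inj = id ; ψ-edge = Joined-par T }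

⊑-trans : ∀ {k l m} {T : Tree k} {T′ : Tree l} {T″ : Tree m} → T ⊑ T′ → T′ ⊑ T″ → T ⊑ T″
⊑-trans s t = record { ψ = ψ t ∘ ψ s ; ψ-inj = ψ-inj s ∘ ψ-inj t ; ψ-edge = λ j → ψ-joined t (ψ-edge s j) }

⊑-leaf : ∀ {k l} {T : Tree k} {T′ : Tree l} (s : T ⊑ T′) {p} → leaf T p ⊑ leaf T′ (ψ s p)
⊑-leaf {k} {l} s = record
  { ψ = ψ′ ; ψ-inj = λ {x} {y} → inj x y
  ; ψ-edge = λ { zero → Joined-new ; (suc j) → Joined-leaf (ψ-edge s j) } }
  where
  ψ′ : Fin (suc (suc k)) → Fin (suc (suc l))
  ψ′ zero    = zero
  ψ′ (suc x) = suc (ψ s x)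
  inj : ∀ x y → ψ′ x ≡ ψ′ y → x ≡ y
  inj zero    zero    e = refl
  inj (suc x) (suc y) e = cong suc (ψ-inj s (suc-injective e))

⊑-swap : ∀ {k} {T : Tree k} {p q} → leaf (leaf T p) (suc q) ⊑ leaf (leaf T q) (suc p)
⊑-swap {k} {T} {p} {q} = record
  { ψ = ψ′ ; ψ-inj = λ {x} {y} → inj x y
  ; ψ-edge = λ { zero → suc zero , inj₁ (refl , refl) ; (suc zero) → zero , inj₁ (refl , refl)
               ; (suc (suc j)) → suc (suc j) , inj₁ (refl , refl) } }
  where
  ψ′ : Fin (suc (suc (suc k))) → Fin (suc (suc (suc k)))
  ψ′ zero          = suc zero
  ψ′ (suc zero)    = zero
  ψ′ (suc (suc x)) = suc (suc x)
  inj : ∀ x y → ψ′ x ≡ ψ′ y → x ≡ y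
  inj zero          zero          e = refl
  inj (suc zero)    (suc zero)    e = refl
  inj (suc (suc x)) (suc (suc y)) e = e
  inj zero (suc zero) ()
  inj zero (suc (suc _)) ()
  inj (suc zero) zero ()
  inj (suc zero) (suc (suc _)) ()
  inj (suc (suc _)) zero ()
  inj (suc (suc _)) (suc zero) ()

-- Every edge takes the triple of its image. Different edges have different images, since an edge of
-- `T′` determines its two ends up to order.
⊑-berge : ∀ {N k l} {χ : Col N} {c} {T : Tree k} {T′ : Tree l} → Symmetric χ → T ⊑ T′ →
          Berge χ c T′ → Berge χ c T
⊑-berge {N} {k} {χ = χ} {c} {T} {T′} χ-sym s B = record
  { φ = φ B ∘ ψ s ; φ-inj = ψ-inj s ∘ φ-inj B ; third = third B ∘ e
  ; third≢child = λ j → proj₁ (apart (proj₂ (ψ-edge s j)))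
  ; third≢parent = λ j → proj₁ (proj₂ (apart (proj₂ (ψ-edge s j))))
  ; colour = λ j → proj₂ (proj₂ (apart (proj₂ (ψ-edge s j))))
  ; distinct = λ {i} {j} t → e-inj i j (distinct B (≈₃-trans (≈₃-sym (same i)) (≈₃-trans t (same j)))) }
  where
  e : Fin k → Fin _
  e j = proj₁ (ψ-edge s j)
  apart : ∀ {j x y} → Join T′ j x y → Third χ c (φ B x) (φ B y) (third B j)
  apart {j} (inj₁ (refl , refl)) = third≢child B j , third≢parent B j , colour B j
  apart {j} (inj₂ (refl , refl)) = third≢parent B j , third≢child B j , trans (swap₁ χ-sym _ _ _) (colour B j)
  same′ : ∀ {j x y} → Join T′ j x y → (φ B x , φ B y , third B j) ≈₃ tri B j
  same′ (inj₁ (refl , refl)) = (1st refl , 2nd refl , 3rd refl) , (1st refl , 2nd refl , 3rd refl)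
  same′ (inj₂ (refl , refl)) = swap₁₂
  same : ∀ j → (φ B (ψ s (inject₁ j)) , φ B (ψ s (par T j)) , third B (e j)) ≈₃ tri B (e j)
  same j = same′ (proj₂ (ψ-edge s j))
  ends : ∀ {l′ x y x′ y′} → Join T′ l′ x y → Join T′ l′ x′ y′ → (x ≡ x′ × y ≡ y′) ⊎ (x ≡ y′ × y ≡ x′)
  ends (inj₁ (refl , refl)) (inj₁ (refl , refl)) = inj₁ (refl , refl)
  ends (inj₁ (refl , refl)) (inj₂ (refl , refl)) = inj₂ (refl , refl)
  ends (inj₂ (refl , refl)) (inj₁ (refl , refl)) = inj₂ (refl , refl)
  ends (inj₂ (refl , refl)) (inj₂ (refl , refl)) = inj₁ (refl , refl)
  e-inj : ∀ i j → e i ≡ e j → i ≡ j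
  e-inj i j eq with ends (proj₂ (ψ-edge s i)) (subst (λ l′ → Join T′ l′ _ _) (sym eq) (proj₂ (ψ-edge s j)))
  ... | inj₁ (a , b) = inject₁-injective (ψ-inj s a)
  ... | inj₂ (a , b) = Join-unique T (inj₁ (refl , refl)) (inj₂ (ψ-inj s b , ψ-inj s a))

-- Choosing distinct triples for the edges

data AtOrIn {n} (i : Fin (suc n)) : Fin (suc n) → Set where
  at : AtOrIn i i
  in′ : ∀ j → AtOrIn i (punchIn i j)

atOrIn : ∀ {n} (i e : Fin (suc n)) → AtOrIn i e
atOrIn i e with i ≟ e
... | yes refl = at
... | no i≢e = subst (AtOrIn i) (punchIn-punchOut i≢e) (in′ (punchOut i≢e))

-- Every e has the options a e and b e, and R e z e′ z′ says that the choices z for e and z′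
-- for e′ exclude each other.
record Choices (n : ℕ) (A : Set) : Set₁ where
  field
    a b   : Fin n → A
    R     : Fin n → A → Fin n → A → Set
    R?    : ∀ e z e′ z′ → Dec (R e z e′ z′)
    R-sym : ∀ {e z e′ z′} → R e z e′ z′ → R e′ z′ e z

  Option : Fin n → A → Set
  Option e z = z ≡ a e ⊎ z ≡ b e

  field
    R-unique : ∀ {e z e′ z′ e″ z″} → Option e z → Option e′ z′ → Option e″ z″ → e ≢ e′ → e ≢ e″ →
               R e z e′ z′ → R e z e″ z″ → e′ ≡ e″ × z′ ≡ z″
    -- An element that can be hit by a conflict has a genuine second option to move to; only an
    -- element that is never hit may have `a e′` equal to `b e′`.
    R-two    : ∀ {e z e′ z′} → Option e z → Option e′ z′ → e ≢ e′ → R e z e′ z′ → a e′ ≢ b e′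

module _ {A : Set} where
  open Choices

  remove : ∀ {n} → Choices (suc n) A → Fin (suc n) → Choices n A
  remove C i = record
    { a = a C ∘ punchIn i ; b = b C ∘ punchIn i
    ; R = λ e z e′ z′ → R C (punchIn i e) z (punchIn i e′) z′
    ; R? = λ e z e′ z′ → R? C _ z _ z′ ; R-sym = R-sym C
    ; R-unique = λ o o′ o″ ne ne′ r r′ → let e , z = R-unique C o o′ o″ (ne ∘ punchIn-injective i _ _)
                                                       (ne′ ∘ punchIn-injective i _ _) r r′
                                         in punchIn-injective i _ _ e , z
    ; R-two = λ o o′ ne → R-two C o o′ (ne ∘ punchIn-injective i _ _) }

  Solution : ∀ {n} → Choices n A → (Fin n → A) → Set
  Solution C g = (∀ e → Option C e (g e)) × (∀ {e e′} → e ≢ e′ → ¬ R C e (g e) e′ (g e′))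

  -- Fixing the choice z at i excludes at most one option elsewhere, at j say; then j takes its
  -- other option, and the same argument applies to the remaining edges.
  solve : ∀ {n} (C : Choices (suc n) A) i z → Option C i z → ∃ λ g → Solution C g × g i ≡ z
  solve {n} C i z o = finish (rest n refl)
    where
    Rest = ∃ λ g → Solution (remove C i) g × (∀ j → ¬ R C i z (punchIn i j) (g j))

    finish : Rest → ∃ λ g → Solution C g × g i ≡ z
    finish (g′ , (opt , free) , ok) = g , (opt′ , free′) , insertAt-lookup g′ i z
      where
      g = insertAt g′ i z
      opt′ : ∀ e → Option C e (g e)
      opt′ e with atOrIn i e
      ... | at rewrite insertAt-lookup g′ i z = o
      ... | in′ j rewrite insertAt-punchIn g′ i z j = opt j
      free′ : ∀ {e e′} → e ≢ e′ → ¬ R C e (g e) e′ (g e′)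
      free′ {e} {e′} ne r with atOrIn i e | atOrIn i e′
      ... | at | at = ne refl
      ... | at | in′ j rewrite insertAt-lookup g′ i z | insertAt-punchIn g′ i z j = ok j r
      ... | in′ j | at rewrite insertAt-lookup g′ i z | insertAt-punchIn g′ i z j = ok j (R-sym C r)
      ... | in′ j | in′ j′ rewrite insertAt-punchIn g′ i z j | insertAt-punchIn g′ i z j′ =
        free (ne ∘ cong (punchIn i)) r

    rest : ∀ m → m ≡ n → Rest
    rest zero refl = a (remove C i) , ((λ ()) , λ { {()} }) , λ ()
    rest (suc m) refl with any? (λ j → R? C i z (punchIn i j) (a C (punchIn i j)))
                         | any? (λ j → R? C i z (punchIn i j) (b C (punchIn i j)))
    ... | yes (j , r) | _ = let g , (opt , free) , gj = solve (remove C i) j (b C (punchIn i j)) (inj₂ refl)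
      in g , (opt , free) , λ j′ r′ →
         let e , e′ = R-unique C o (inj₁ refl) (opt j′) (≢-sym (punchInᵢ≢i i j)) (≢-sym (punchInᵢ≢i i j′)) r r′
         in R-two C o (inj₁ refl) (≢-sym (punchInᵢ≢i i j)) r
              (trans e′ (trans (cong g (sym (punchIn-injective i _ _ e))) gj))
    ... | no _ | yes (j , r) = let g , (opt , free) , gj = solve (remove C i) j (a C (punchIn i j)) (inj₁ refl)
      in g , (opt , free) , λ j′ r′ →
         let e , e′ = R-unique C o (inj₂ refl) (opt j′) (≢-sym (punchInᵢ≢i i j)) (≢-sym (punchInᵢ≢i i j′)) r r′
         in R-two C o (inj₂ refl) (≢-sym (punchInᵢ≢i i j)) r
              (sym (trans e′ (trans (cong g (sym (punchIn-injective i _ _ e))) gj)))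
    ... | no ¬a | no ¬b = let g , (opt , free) , _ = solve (remove C i) zero (a C (punchIn i zero)) (inj₁ refl)
      in g , (opt , free) , λ j r → Sum.[ (λ e → ¬a (j , subst (R C i z _) e r))
                                       , (λ e → ¬b (j , subst (R C i z _) e r)) ] (opt j)

  solution : ∀ {n} (C : Choices n A) → ∃ (Solution C)
  solution {zero}  C = a C , (λ ()) , λ { {()} }
  solution {suc n} C = let g , s , _ = solve C zero (a C zero) (inj₁ refl) in g , s

∈₃? : ∀ {A : Set} → DecidableEquality A → (w : A) (t : Tri A) → Dec (w ∈₃ t)
∈₃? _≟′_ w (x , y , z) = (w ≟′ x) ⊎-dec (w ≟′ y) ⊎-dec (w ≟′ z)

≈₃? : ∀ {A : Set} → DecidableEquality A → (s t : Tri A) → Dec (s ≈₃ t)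
≈₃? d s t = ⊆? s t ×-dec ⊆? t s
  where
  ⊆? : ∀ s t → Dec (s ⊆₃ t)
  ⊆? (x , y , z) t = ∈₃? d x t ×-dec ∈₃? d y t ×-dec ∈₃? d z t

module _ {A : Set} {k : ℕ} (T : Tree k) (φ : Fin (suc k) → A) (φ-inj : ∀ {x y} → φ x ≡ φ y → x ≡ y) where

  triple : Fin k → A → Tri A
  triple j z = φ (inject₁ j) , φ (par T j) , z

  -- Of three edges inside one triple, the one with the oldest child also has its parent there,
  -- which makes four vertices.
  no-triangle′ : ∀ {t i j l zi zj zl} → triple i zi ⊆₃ t → triple j zj ⊆₃ t → triple l zl ⊆₃ t →
                 i ≢ j → toℕ i ℕ.< toℕ l → toℕ j ℕ.< toℕ l → ⊥
  no-triangle′ {i = i} {j} {l} (pi , _) (pj , _) (pl , pl′ , _) i≢j i<l j<l = four-in-triple pi pj pl pl′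
    (i≢j ∘ inject₁-injective ∘ φ-inj) (younger i<l ∘ inject₁-injective ∘ φ-inj)
    (younger-par i<l ∘ φ-inj) (younger j<l ∘ inject₁-injective ∘ φ-inj) (younger-par j<l ∘ φ-inj)
    (inject₁≢par T l ∘ φ-inj)
    where
    younger : ∀ {x} → toℕ x ℕ.< toℕ l → x ≢ l
    younger x<l refl = ℕ.<-irrefl refl x<l
    younger-par : ∀ {x} → toℕ x ℕ.< toℕ l → inject₁ x ≢ par T l
    younger-par {x} x<l e = ℕ.<-irrefl (trans (sym (toℕ-inject₁ x)) (cong toℕ e)) (ℕ.<-trans x<l (par> T l))

  no-triangle : ∀ {t i j l zi zj zl} → triple i zi ⊆₃ t → triple j zj ⊆₃ t → triple l zl ⊆₃ t →
                i ≢ j → i ≢ l → j ≢ l → ⊥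
  no-triangle {t} {i} {j} {l} {zi} {zj} {zl} pi pj pl ij il jl with <-or i j ij | <-or i l il | <-or j l jl
    where
    <-or : ∀ {n} (x y : Fin n) → x ≢ y → toℕ x ℕ.< toℕ y ⊎ toℕ y ℕ.< toℕ x
    <-or x y ne with ℕ.<-cmp (toℕ x) (toℕ y)
    ... | tri< a _ _ = inj₁ a
    ... | tri≈ _ b _ = ⊥-elim (ne (toℕ-injective b))
    ... | tri> _ _ c = inj₂ c
  ... | _ | inj₁ i<l | inj₁ j<l = no-triangle′ {zi = zi} {zj} {zl} pi pj pl ij i<l j<l
  ... | inj₁ i<j | _ | inj₂ l<j = no-triangle′ {zi = zi} {zl} {zj} pi pl pj il i<j l<j
  ... | inj₂ j<i | inj₂ l<i | _ = no-triangle′ {zi = zj} {zl} {zi} pj pl pi jl j<i l<i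
  ... | inj₁ i<j | inj₂ l<i | inj₁ j<l = ⊥-elim (ℕ.<-asym (ℕ.<-trans i<j j<l) l<i)
  ... | inj₂ j<i | inj₁ i<l | inj₂ l<j = ⊥-elim (ℕ.<-asym (ℕ.<-trans j<i i<l) l<j)


module _ {N k : ℕ} {χ : Col N} {c : Colour} (T : Tree k) (φ : Fin (suc k) → Fin N)
         (φ-inj : ∀ {x y} → φ x ≡ φ y → x ≡ y) where

  -- Three tree edges never lie in one triple, so a chosen triple is claimed by at most one other
  -- edge, and for that edge the third vertex is determined. Hence two options per edge suffice. The
  -- last hypothesis also admits an edge with a single option if no other edge can claim its triple;
  -- `OnePartner` relies on this.
  hall : (a b : Fin k → Fin N) →
         (∀ j → Third χ c (φ (inject₁ j)) (φ (par T j)) (a j)) →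
         (∀ j → Third χ c (φ (inject₁ j)) (φ (par T j)) (b j)) →
         (∀ {i z j z′} → z ≡ a i ⊎ z ≡ b i → z′ ≡ a j ⊎ z′ ≡ b j → i ≢ j →
            triple T φ φ-inj i z ≈₃ triple T φ φ-inj j z′ → a j ≢ b j) →
         Berge χ c T
  hall a b a-third b-third two = berge (solution C)
    where
    tr = triple T φ φ-inj
    third′ : ∀ {j z} → z ≡ a j ⊎ z ≡ b j → Third χ c (φ (inject₁ j)) (φ (par T j)) z
    third′ (inj₁ refl) = a-third _
    third′ (inj₂ refl) = b-third _
    unique : ∀ {e z e′ z′ e″ z″} → z ≡ a e ⊎ z ≡ b e → z′ ≡ a e′ ⊎ z′ ≡ b e′ → z″ ≡ a e″ ⊎ z″ ≡ b e″ →
             e ≢ e′ → e ≢ e″ → tr e z ≈₃ tr e′ z′ → tr e z ≈₃ tr e″ z″ → e′ ≡ e″ × z′ ≡ z″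
    unique {e} {z} {e′} {z′} {e″} {z″} o o′ o″ n n′ r r′ with e′ ≟ e″
    ... | no e′≢e″ = ⊥-elim (no-triangle T φ φ-inj {t = tr e z} {zi = z} {z′} {z″}
                               (1st refl , 2nd refl , 3rd refl) (proj₂ r) (proj₂ r′) n n′ e′≢e″)
    ... | yes refl with ∈₃-⊆₃ {s = tr e z} (proj₂ (proj₂ (proj₂ r))) (proj₁ r′) | third′ o′
    ...   | 1st eq | ne , _ = ⊥-elim (ne eq)
    ...   | 2nd eq | _ , ne , _ = ⊥-elim (ne eq)
    ...   | 3rd eq | _ = refl , eq
    C : Choices k (Fin N)
    C = record { a = a ; b = b ; R = λ e z e′ z′ → tr e z ≈₃ tr e′ z′ ; R? = λ e z e′ z′ → ≈₃? _≟_ _ _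
               ; R-sym = ≈₃-sym ; R-unique = unique ; R-two = two }
    berge : ∃ (Solution C) → Berge χ c T
    berge (g , opt , free) = record
      { φ = φ ; φ-inj = φ-inj ; third = g
      ; third≢child = λ j → proj₁ (third′ (opt j)) ; third≢parent = λ j → proj₁ (proj₂ (third′ (opt j)))
      ; colour = λ j → proj₂ (proj₂ (third′ (opt j)))
      ; distinct = λ {i} {j} → dist i j }
      where
      dist : ∀ i j → tr i (g i) ≈₃ tr j (g j) → i ≡ j
      dist i j r with i ≟ j
      ... | yes e = e
      ... | no ne = ⊥-elim (free ne r)

-- Search in small colourings

_≟ᶜ_ : (c d : Colour) → Dec (c ≡ d)
blue ≟ᶜ blue = yes refl
blue ≟ᶜ red  = no λ ()
red  ≟ᶜ blue = no λ ()
red  ≟ᶜ red  = yes refl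

P₄ : Tree 3
P₄ = leaf (leaf (leaf root zero) zero) zero

code : ∀ {N} → Fin N → ℕ
code x = 2 ℕ.^ toℕ x

-- Candidates are produced by an unverified backtracking search, in which a triple is
-- represented by the sum of the powers 2^x of its elements; only the outcome is checked.
record Candidate (N : ℕ) : Set where
  constructor candidate
  field
    vertices  : List (Fin N × ℕ)
    thirds    : List (Fin N)
    usedCodes : List ℕ

elemᵇ : ℕ → List ℕ → Bool
elemᵇ m []       = false
elemᵇ m (n ∷ ns) = if m ≡ᵇ n then true else elemᵇ m ns

nth : ∀ {k} → Fin (suc k) → List ℕ → ℕ
nth i       []       = 0
nth zero    (x ∷ xs) = x
nth {suc k} (suc i) (x ∷ xs) = nth i xs

coded : ∀ {N} → List (Fin N) → List (Fin N × ℕ)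
coded = List.map λ x → x , code x

-- `H` decides from the code whether a triple has the wanted colour, and `hosts` lists the places
-- tried for the root. Unsuitable values can only make the search fail, since `check` tests every
-- triple against the colouring itself.
candidates : ∀ {N k} → (ℕ → Bool) → List (Fin N) → Tree k → List (Candidate N)
candidates     H hosts root       = List.map (λ x → candidate (x ∷ []) [] []) (coded hosts)
candidates {N} H hosts (leaf T p) = concatMap extend (candidates H hosts T)
  where
  extend : Candidate N → List (Candidate N)
  extend (candidate vs zs used) = concatMap vertex (coded (allFin N))
    where
    codes = List.map proj₂ vs
    y = nth p codes
    vertex : Fin N × ℕ → List (Candidate N)
    vertex (v , m) = if elemᵇ m codes then [] else concatMap third′ (coded (allFin N))
      where
      third′ : Fin N × ℕ → List (Candidate N)
      third′ (z , l) = if (l ≡ᵇ m) ∨ (l ≡ᵇ y) then [] else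
        if H (m ℕ.+ y ℕ.+ l) then (if elemᵇ (m ℕ.+ y ℕ.+ l) used then [] else
          (candidate ((v , m) ∷ vs) (z ∷ zs) (m ℕ.+ y ℕ.+ l ∷ used) ∷ [])) else []

module Search {N : ℕ} (χ : Col N) (c : Colour) where

  third? : ∀ x y z → Dec (Third χ c x y z)
  third? x y z = ¬? (z ≟ x) ×-dec ¬? (z ≟ y) ×-dec (χ x y z ≟ᶜ c)

  check : ∀ {k} (T : Tree k) → List (Fin N × ℕ) → List (Fin N) → Maybe (Berge χ c T)
  check root ((v , _) ∷ _) _ = just record
    { φ = λ _ → v ; φ-inj = λ { {zero} {zero} _ → refl } ; third = λ () ; third≢child = λ () ; third≢parent = λ ()
    ; colour = λ () ; distinct = λ { {()} } }
  check (leaf T p) ((v , _) ∷ vs) (z ∷ zs) with check T vs zs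
  ... | nothing = nothing
  ... | just B with all? (λ i → ¬? (φ B i ≟ v)) | third? v (φ B p) z
                  | all? (λ j → ¬? (≈₃? _≟_ (v , φ B p , z) (tri B j)))
  ...   | yes new | yes t | yes fresh = just (addLeaf B p v z new t fresh)
  ...   | _       | _     | _         = nothing
  check _ _ _ = nothing

  search : ∀ {k} → (ℕ → Bool) → List (Fin N) → (T : Tree k) → Maybe (Berge χ c T)
  search H hosts T with candidates H hosts T
  ... | []    = nothing
  ... | C ∷ _ = check T (Candidate.vertices C) (Candidate.thirds C)

  found : ∀ {k} → (ℕ → Bool) → List (Fin N) → Tree k → Bool
  found H hosts T = is-just (search H hosts T)

  found-berge : ∀ {k} H hosts (T : Tree k) → found H hosts T ≡ true → Berge χ c T
  found-berge H hosts T e with search H hosts T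
  found-berge H hosts T () | nothing
  found-berge H hosts T e | just B = B

allᵇ : ∀ {n} → (Fin n → Bool) → Bool
allᵇ {zero}  f = true
allᵇ {suc n} f = f zero ∧ allᵇ (f ∘ suc)

has : ∀ {N} → Fin N → Tri (Fin N) → Bool
has w t = does (∈₃? _≟_ w t)

meets : ∀ {N} → List (Fin N × Fin N) → Tri (Fin N) → Bool
meets []            t = false
meets ((u , w) ∷ P) t = (has u t ∧ has w t) ∨ meets P t

-- Only the triples forced by the pairs in `P` are blue. A blue copy found here therefore exists in
-- every colouring in which these pairs are pure.
spanned : ∀ {N} → List (Fin N × Fin N) → Col N
spanned P x y z = if meets P (x , y , z) then blue else red

-- Unavoidable patterns of pure pairs: a graph without isolated vertices contains `path₃` or
-- `matching₄` if it has at least three vertices, and `star₄` or `matching₄` if it has at least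
-- four.
path₃ star₄ matching₄ : ∀ {N} → List (Fin (4 ℕ.+ N) × Fin (4 ℕ.+ N))
path₃     = (# 0 , # 1) ∷ (# 0 , # 2) ∷ []
star₄     = (# 0 , # 1) ∷ (# 0 , # 2) ∷ (# 0 , # 3) ∷ []
matching₄ = (# 0 , # 1) ∷ (# 2 , # 3) ∷ []

-- Up to isomorphism, the only non-stars on five vertices
nonStar₅ : Fin 2 → Tree 4
nonStar₅ zero       = leaf P₄ zero
nonStar₅ (suc zero) = leaf P₄ (suc zero)

bit : ℕ → ℕ → Bool
bit i m = (m ℕ./ (2 ℕ.^ i)) {{ℕ.m^n≢0 2 i}} ℕ.% 2 ≡ᵇ 1

meetsᵇ : ∀ {N} → List (Fin N × Fin N) → ℕ → Bool
meetsᵇ []            m = false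
meetsᵇ ((u , w) ∷ P) m = (bit (toℕ u) m ∧ bit (toℕ w) m) ∨ meetsᵇ P m

-- Six and seven vertices are too few for the induction that removes two vertices, since the
-- theorem fails for two stars on five vertices and for all trees on four.
contains₆ : List (Fin 6 × Fin 6) → Bool
contains₆ P = allᵇ λ i → allᵇ λ p → Search.found (spanned P) blue (meetsᵇ P) (allFin 6) (leaf (nonStar₅ i) p)

contains₇ : List (Fin 7 × Fin 7) → Bool
contains₇ P = allᵇ λ i → allᵇ λ p → allᵇ λ q →
  Search.found (spanned P) blue (meetsᵇ P) (allFin 7) (leaf (leaf (nonStar₅ i) p) q)

abstract
  path₃-contains₆ : contains₆ path₃ ≡ true
  path₃-contains₆ = refl

  matching₄-contains₆ : contains₆ matching₄ ≡ true
  matching₄-contains₆ = refl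

  star₄-contains₇ : contains₇ star₄ ≡ true
  star₄-contains₇ = refl

  matching₄-contains₇ : contains₇ matching₄ ≡ true
  matching₄-contains₇ = refl

opp : Colour → Colour
opp blue = red
opp red  = blue

opp-opp : ∀ c → opp (opp c) ≡ c
opp-opp blue = refl
opp-opp red  = refl

≢→opp : ∀ {c d} → d ≢ c → d ≡ opp c
≢→opp {blue} {blue} ne = ⊥-elim (ne refl)
≢→opp {blue} {red}  ne = refl
≢→opp {red}  {blue} ne = refl
≢→opp {red}  {red}  ne = ⊥-elim (ne refl)

opp≢ : ∀ c → c ≢ opp c
opp≢ blue ()
opp≢ red ()

module _ {N : ℕ} {χ : Col N} (χ-sym : Symmetric χ) where

  colour-⊆ : ∀ {x y z a b c} → x ≢ y → x ≢ z → y ≢ z → (x , y , z) ⊆₃ (a , b , c) → χ x y z ≡ χ a b c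
  colour-⊆ xy xz yz (1st refl , 2nd refl , 3rd refl) = refl
  colour-⊆ xy xz yz (1st refl , 3rd refl , 2nd refl) = swap₂ χ-sym _ _ _
  colour-⊆ xy xz yz (2nd refl , 1st refl , 3rd refl) = swap₁ χ-sym _ _ _
  colour-⊆ xy xz yz (2nd refl , 3rd refl , 1st refl) = sym (rot χ-sym _ _ _)
  colour-⊆ xy xz yz (3rd refl , 1st refl , 2nd refl) = rot χ-sym _ _ _
  colour-⊆ xy xz yz (3rd refl , 2nd refl , 1st refl) = trans (rot χ-sym _ _ _) (swap₁ χ-sym _ _ _)
  colour-⊆ xy xz yz (1st refl , 1st refl , _) = ⊥-elim (xy refl)
  colour-⊆ xy xz yz (2nd refl , 2nd refl , _) = ⊥-elim (xy refl)
  colour-⊆ xy xz yz (3rd refl , 3rd refl , _) = ⊥-elim (xy refl)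
  colour-⊆ xy xz yz (1st refl , 2nd refl , 1st refl) = ⊥-elim (xz refl)
  colour-⊆ xy xz yz (1st refl , 3rd refl , 1st refl) = ⊥-elim (xz refl)
  colour-⊆ xy xz yz (2nd refl , 1st refl , 2nd refl) = ⊥-elim (xz refl)
  colour-⊆ xy xz yz (2nd refl , 3rd refl , 2nd refl) = ⊥-elim (xz refl)
  colour-⊆ xy xz yz (3rd refl , 1st refl , 3rd refl) = ⊥-elim (xz refl)
  colour-⊆ xy xz yz (3rd refl , 2nd refl , 3rd refl) = ⊥-elim (xz refl)
  colour-⊆ xy xz yz (1st refl , 2nd refl , 2nd refl) = ⊥-elim (yz refl)
  colour-⊆ xy xz yz (1st refl , 3rd refl , 3rd refl) = ⊥-elim (yz refl)
  colour-⊆ xy xz yz (2nd refl , 1st refl , 1st refl) = ⊥-elim (yz refl)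
  colour-⊆ xy xz yz (2nd refl , 3rd refl , 3rd refl) = ⊥-elim (yz refl)
  colour-⊆ xy xz yz (3rd refl , 1st refl , 1st refl) = ⊥-elim (yz refl)
  colour-⊆ xy xz yz (3rd refl , 2nd refl , 2nd refl) = ⊥-elim (yz refl)

recolour : ∀ {M N k} {χ : Col M} {χ′ : Col N} {c c′} {T : Tree k} (ι : Fin M → Fin N) →
           (∀ {x y} → ι x ≡ ι y → x ≡ y) →
           (∀ {x y z} → x ≢ y → z ≢ x → z ≢ y → χ x y z ≡ c → χ′ (ι x) (ι y) (ι z) ≡ c′) →
           Berge χ c T → Berge χ′ c′ T
recolour {T = T} ι ι-inj mono B = relabel ι-inj record
  { φ = φ B ; φ-inj = φ-inj B ; third = third B ; third≢child = third≢child B ; third≢parent = third≢parent B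
  ; colour = λ j → mono (inject₁≢par T j ∘ φ-inj B) (third≢child B j) (third≢parent B j) (colour B j)
  ; distinct = distinct B }

-- Stars, non-stars and the Ramsey relation

star : ∀ k → Tree k
star zero    = root
star (suc k) = leaf (star k) (fromℕ k)

par-star : ∀ k j → par (star k) j ≡ fromℕ k
par-star (suc k) zero    = refl
par-star (suc k) (suc j) = cong suc (par-star k j)

-- A tree that is not a star contains a path on four vertices and can be grown from it. Placing this
-- path first lets inductions on non-stars start at `P₄`.
data NonStar : ∀ {k} → Tree k → Set where
  path : NonStar P₄
  more : ∀ {k} {T : Tree k} {p} → NonStar T → NonStar (leaf T p)

exchange : ∀ {N k l} {χ : Col N} {c} {T : Tree k} {T′ : Tree l} →
           Berge χ (opp c) T′ ⊎ Berge χ (opp (opp c)) T → Berge χ c T ⊎ Berge χ (opp c) T′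
exchange {χ = χ} {c} {T} = [ inj₂ , (λ B → inj₁ (subst (λ d → Berge χ d T) (opp-opp c) B)) ]′

infix 3 _⟶_

-- Both trees have as many vertices as the colouring. Quantifying over `c` makes the relation
-- symmetric, see `⟶-swap`.
_⟶_ : ∀ {k} → Tree k → Tree k → Set
_⟶_ {k} T T′ = ∀ (χ : Col (suc k)) → Symmetric χ → ∀ c → Berge χ c T ⊎ Berge χ (opp c) T′

-- Exhaustive checks over ten coloured objects

∧-true : ∀ a b → a ∧ b ≡ true → a ≡ true × b ≡ true
∧-true true true refl = refl , refl

∨-true : ∀ a b → a ∨ b ≡ true → a ≡ true ⊎ b ≡ true
∨-true true  b e = inj₁ refl
∨-true false b e = inj₂ e

allᵇ-true : ∀ {n} (f : Fin n → Bool) → allᵇ f ≡ true → ∀ i → f i ≡ true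
allᵇ-true f e zero    = proj₁ (∧-true (f zero) _ e)
allᵇ-true f e (suc i) = allᵇ-true (f ∘ suc) (proj₂ (∧-true (f zero) _ e)) i

allColours : ∀ n → (Vec Colour n → Bool) → Bool
allColours zero    f = f []
allColours (suc n) f = allColours n (f ∘ (blue ∷_)) ∧ allColours n (f ∘ (red ∷_))

allColours-true : ∀ {n} (f : Vec Colour n → Bool) → allColours n f ≡ true → ∀ v → f v ≡ true
allColours-true f e []         = e
allColours-true f e (blue ∷ v) =
  allColours-true (f ∘ (blue ∷_)) (proj₁ (∧-true (allColours _ (f ∘ (blue ∷_))) _ e)) v
allColours-true f e (red ∷ v)  =
  allColours-true (f ∘ (red ∷_)) (proj₂ (∧-true (allColours _ (f ∘ (blue ∷_))) _ e)) v

-- A subset of Fin 5 is encoded by the sum of the powers 2^x of its elements; the ten pairs are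
-- numbered in increasing order of their codes.
2^ : Fin 5 → ℕ
2^ zero = 1
2^ (suc zero) = 2
2^ (suc (suc zero)) = 4
2^ (suc (suc (suc zero))) = 8
2^ (suc (suc (suc (suc zero)))) = 16

pairIndex : ℕ → Fin 10
pairIndex 3  = # 0
pairIndex 5  = # 1
pairIndex 6  = # 2
pairIndex 9  = # 3
pairIndex 10 = # 4
pairIndex 12 = # 5
pairIndex 17 = # 6
pairIndex 18 = # 7
pairIndex 20 = # 8
-- The tenth pair has code 24; the value at a number that is not the code of a pair is arbitrary.
pairIndex _  = # 9

pairs : Vec (Fin 5 × Fin 5) 10
pairs = (# 0 , # 1) ∷ (# 0 , # 2) ∷ (# 1 , # 2) ∷ (# 0 , # 3) ∷ (# 1 , # 3) ∷ (# 2 , # 3) ∷ (# 0 , # 4)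
      ∷ (# 1 , # 4) ∷ (# 2 , # 4) ∷ (# 3 , # 4) ∷ []

-- The complements of the ten pairs, in the same order. A triple is stored under its complementary
-- pair, whose code is obtained by subtraction from 31, the code of all five elements.
cotriples : Vec (Tri (Fin 5)) 10
cotriples = (# 2 , # 3 , # 4) ∷ (# 1 , # 3 , # 4) ∷ (# 0 , # 3 , # 4) ∷ (# 1 , # 2 , # 4) ∷ (# 0 , # 2 , # 4)
          ∷ (# 0 , # 1 , # 4) ∷ (# 1 , # 2 , # 3) ∷ (# 0 , # 2 , # 3) ∷ (# 0 , # 1 , # 3) ∷ (# 0 , # 1 , # 2) ∷ []

pairIndex-correct : ∀ x y → x ≡ y ⊎ lookup pairs (pairIndex (2^ x ℕ.+ 2^ y)) ≡ (x , y)
                                  ⊎ lookup pairs (pairIndex (2^ x ℕ.+ 2^ y)) ≡ (y , x)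
pairIndex-correct = from-yes (all? λ x → all? λ y → (x ≟ y)
  ⊎-dec (lookup pairs (pairIndex (2^ x ℕ.+ 2^ y)) ≟₂ (x , y))
  ⊎-dec (lookup pairs (pairIndex (2^ x ℕ.+ 2^ y)) ≟₂ (y , x)))
  where
  _≟₂_ = ≡-dec (_≟_ {5}) (_≟_ {5})

cotriple-correct : ∀ x y z → (x ≡ y ⊎ z ≡ x ⊎ z ≡ y)
                           ⊎ (x , y , z) ≈₃ lookup cotriples (pairIndex (31 ℕ.∸ (2^ x ℕ.+ (2^ y ℕ.+ 2^ z))))
cotriple-correct = from-yes (all? λ x → all? λ y → all? λ z →
  ((x ≟ y) ⊎-dec (z ≟ x) ⊎-dec (z ≟ y)) ⊎-dec
  ≈₃? _≟_ (x , y , z) (lookup cotriples (pairIndex (31 ℕ.∸ (2^ x ℕ.+ (2^ y ℕ.+ 2^ z))))))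

colouring₅ : Vec Colour 10 → Col 5
colouring₅ v x y z = lookup v (pairIndex (31 ℕ.∸ (2^ x ℕ.+ (2^ y ℕ.+ 2^ z))))

-- Only triples with parent 0 matter for a star centred at 0.
link₆ : Vec Colour 10 → Col 6
link₆ v (suc x) zero (suc z) = lookup v (pairIndex (2^ x ℕ.+ 2^ z))
link₆ v _ _ _ = red

isBlue : Colour → Bool
isBlue blue = true
isBlue red  = false

-- In `hyper₆`, an odd code means that the triple contains 0; halving then leaves the code of the
-- other two vertices, each shifted down by one.
hyper₅ hyper₆ : Vec Colour 10 → ℕ → Bool
hyper₅ v m = isBlue (lookup v (pairIndex (31 ℕ.∸ m)))
hyper₆ v m = (m ℕ.% 2 ≡ᵇ 1) ∧ isBlue (lookup v (pairIndex (m ℕ./ 2)))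

-- Only a vertex in at least four triples can be the centre of a star.
hosts₅ : Vec Colour 10 → List (Fin 5)
hosts₅ v = filterᵇ (λ x → 4 ≤ᵇ degree x) (allFin 5)
  where
  degree : Fin 5 → ℕ
  degree x = sum (List.map (λ i → if isBlue (lookup v i) ∧ has x (lookup cotriples i) then 1 else 0) (allFin 10))

found₅ : Vec Colour 10 → Fin 2 → Bool
found₅ v i = Search.found (colouring₅ v) blue (hyper₅ v) (allFin 5) (nonStar₅ i)

star₄? : Vec Colour 10 → Bool
star₄? v = Search.found (colouring₅ v) blue (hyper₅ v) (hosts₅ v) (star 4)

blues : ∀ {n} → Vec Colour n → ℕ
blues []         = 0
blues (blue ∷ v) = suc (blues v)
blues (red ∷ v)  = blues v

-- Five of the ten triples contain every non-star on five vertices, and six of them also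
-- contain the star.
check₅ : Vec Colour 10 → Bool
check₅ v = (blues v ≤ᵇ 4) ∨ (allᵇ (found₅ v) ∧ ((blues v ≤ᵇ 5) ∨ star₄? v))

monochromatic? : ∀ v c → Dec (∃ λ x → ∀ y → x ≡ y ⊎ lookup v (pairIndex (2^ x ℕ.+ 2^ y)) ≡ c)
monochromatic? v c = any? λ x → all? λ y → (x ≟ y) ⊎-dec (_ ≟ᶜ _)

star₅? : Vec Colour 10 → Bool
star₅? v = Search.found (link₆ v) blue (hyper₆ v) (zero ∷ []) (star 5)

-- A graph with five edges on five vertices and no isolated vertex is connected and has a cycle.
check₆ : Vec Colour 10 → Bool
check₆ v = (blues v ≤ᵇ 4) ∨ (does (monochromatic? v red) ∨ star₅? v)

does-true : ∀ {P : Set} (d : Dec P) → does d ≡ true → P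
does-true (yes p) e = p

≤ᵇ-true : ∀ {m n} → (m ≤ᵇ n) ≡ true → m ℕ.≤ n
≤ᵇ-true {m} {n} e = ℕ.≤ᵇ⇒≤ m n (subst Bool.T (sym e) _)

abstract
  check₅-true : allColours 10 check₅ ≡ true
  check₅-true = refl

  check₆-true : allColours 10 check₆ ≡ true
  check₆-true = refl

five-triples : ∀ v → 5 ℕ.≤ blues v → (∀ i → Berge (colouring₅ v) blue (nonStar₅ i)) ×
                                     (6 ℕ.≤ blues v → Berge (colouring₅ v) blue (star 4))
five-triples v le with ∨-true (blues v ≤ᵇ 4) _ (allColours-true check₅ check₅-true v)
... | inj₁ e = ⊥-elim (ℕ.<⇒≱ le (≤ᵇ-true e))
... | inj₂ e with ∧-true (allᵇ (found₅ v)) _ e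
...   | e₁ , e₂ = (λ i → Search.found-berge (colouring₅ v) blue (hyper₅ v) (allFin 5) (nonStar₅ i)
                           (allᵇ-true (found₅ v) e₁ i))
                , λ le′ → [ (λ e₃ → ⊥-elim (ℕ.<⇒≱ le′ (≤ᵇ-true e₃)))
                          , Search.found-berge (colouring₅ v) blue (hyper₅ v) (hosts₅ v) (star 4) ]′
                          (∨-true (blues v ≤ᵇ 5) (star₄? v) e₂)

-- In a connected graph with a cycle every vertex can choose an incident edge of its own, by
-- following edges towards the cycle. Adding the vertex 0 to these edges gives the triples of a star
-- centred at 0.
five-edges : ∀ v → 5 ℕ.≤ blues v → (∃ λ x → ∀ y → x ≡ y ⊎ lookup v (pairIndex (2^ x ℕ.+ 2^ y)) ≡ red)
                                   ⊎ Berge (link₆ v) blue (star 5)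
five-edges v le with ∨-true (blues v ≤ᵇ 4) _ (allColours-true check₆ check₆-true v)
... | inj₁ e = ⊥-elim (ℕ.<⇒≱ le (≤ᵇ-true e))
... | inj₂ e = Sum.map (does-true (monochromatic? v red))
  (Search.found-berge (link₆ v) blue (hyper₆ v) (zero ∷ []) (star 5))
  (∨-true (does (monochromatic? v red)) (star₅? v) e)

-- Structure of non-stars

star-swap : ∀ k → leaf (star (suc (suc k))) zero ⊑ leaf (star (suc (suc k))) (suc zero)
star-swap k = ⊑-leaf (⊑-swap {T = star k} {fromℕ k} {fromℕ k})

P₃-swap : leaf (star 1) zero ⊑ star 2
P₃-swap = record { ψ = ψ′ ; ψ-inj = λ {x} {y} → inj x y
                 ; ψ-edge = λ { zero → # 0 , inj₁ (refl , refl) ; (suc zero) → # 1 , inj₂ (refl , refl) } }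
  where
  ψ′ : Fin 3 → Fin 3
  ψ′ zero             = # 0
  ψ′ (suc zero)       = # 2
  ψ′ (suc (suc zero)) = # 1
  inj : ∀ x y → ψ′ x ≡ ψ′ y → x ≡ y
  inj = from-yes (all? λ x → all? λ y → (ψ′ x ≟ ψ′ y) →-dec (x ≟ y))

toP₄ : leaf (star 2) (suc zero) ⊑ P₄
toP₄ = record { ψ = ψ′ ; ψ-inj = λ {x} {y} → inj x y
              ; ψ-edge = λ { zero → # 0 , inj₁ (refl , refl) ; (suc zero) → # 2 , inj₂ (refl , refl)
                           ; (suc (suc zero)) → # 1 , inj₁ (refl , refl) } }
  where
  ψ′ : Fin 4 → Fin 4
  ψ′ zero                   = # 0
  ψ′ (suc zero)             = # 3
  ψ′ (suc (suc zero))       = # 1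
  ψ′ (suc (suc (suc zero))) = # 2
  inj : ∀ x y → ψ′ x ≡ ψ′ y → x ≡ y
  inj = from-yes (all? λ x → all? λ y → (ψ′ x ≟ ψ′ y) →-dec (x ≟ y))

P₄-reverse : P₄ ⊑ P₄
P₄-reverse = record { ψ = opposite ; ψ-inj = λ {x} {y} → inj x y
                    ; ψ-edge = λ { zero → # 2 , inj₂ (refl , refl) ; (suc zero) → # 1 , inj₂ (refl , refl)
                                 ; (suc (suc zero)) → # 0 , inj₂ (refl , refl) } }
  where
  inj : (x y : Fin 4) → opposite x ≡ opposite y → x ≡ y
  inj = from-yes (all? λ (x : Fin 4) → all? λ (y : Fin 4) → (opposite x ≟ opposite y) →-dec (x ≟ y))

InNonStar : ∀ {k} → Tree k → Set
InNonStar {k} T = Σ[ Q ∈ Tree k ] NonStar Q × T ⊑ Q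

⊑-nonStar : ∀ {k} {T T′ : Tree k} → T ⊑ T′ → InNonStar T′ → InNonStar T
⊑-nonStar s (Q , q , t) = Q , q , ⊑-trans s t

leaf-nonStar : ∀ {k} {T : Tree k} {p} → InNonStar T → InNonStar (leaf T p)
leaf-nonStar (Q , q , s) = _ , more q , ⊑-leaf s

-- The new leaf hangs from a leaf of the star. If this is not the last leaf of the star, the last
-- leaf can be attached afterwards and the induction applies to the rest; if it is, it is first
-- exchanged with the leaf before it.
starLeaf-nonStar : ∀ k x → x ≢ fromℕ (suc (suc k)) → InNonStar (leaf (star (suc (suc k))) x)
starLeaf-nonStar zero zero             ne = P₄ , path , ⊑-trans (star-swap 0) toP₄
starLeaf-nonStar zero (suc zero)       ne = P₄ , path , toP₄
starLeaf-nonStar zero (suc (suc zero)) ne = ⊥-elim (ne refl)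
starLeaf-nonStar (suc k) (suc x) ne =
  ⊑-nonStar ⊑-swap (leaf-nonStar (starLeaf-nonStar k x (ne ∘ cong suc)))
starLeaf-nonStar (suc k) zero    ne =
  ⊑-nonStar (star-swap (suc k)) (⊑-nonStar ⊑-swap (leaf-nonStar (starLeaf-nonStar k zero λ ())))

star-or-not : ∀ {k} (T : Tree k) → T ⊑ star k ⊎ InNonStar T
star-or-not root = inj₁ ⊑-refl
star-or-not (leaf {k} T p) with star-or-not T
... | inj₂ n = inj₂ (leaf-nonStar n)
... | inj₁ s with ψ s p ≟ fromℕ k
...   | yes e = inj₁ (subst (λ x → leaf T p ⊑ leaf (star k) x) e (⊑-leaf s))
...   | no ne = Sum.map (⊑-trans (⊑-leaf s)) (⊑-nonStar (⊑-leaf s)) (go k (ψ s p) ne)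
  where
  go : ∀ k x → x ≢ fromℕ k → leaf (star k) x ⊑ star (suc k) ⊎ InNonStar (leaf (star k) x)
  go zero          zero       ne = ⊥-elim (ne refl)
  -- Either end of a single edge can serve as the centre, so this attachment still gives a star.
  go (suc zero)    zero       ne = inj₁ P₃-swap
  go (suc zero)    (suc zero) ne = ⊥-elim (ne refl)
  go (suc (suc k)) x          ne = inj₂ (starLeaf-nonStar k x ne)

data NonStar₅ : ∀ {k} → Tree k → Set where
  base : ∀ i → NonStar₅ (nonStar₅ i)
  more : ∀ {k} {T : Tree k} {p} → NonStar₅ T → NonStar₅ (leaf T p)

-- Reversing `P₄` exchanges its ends and its inner vertices, so two of the four places for a fifth
-- vertex suffice.
toNonStar₅ : ∀ {k} {T : Tree (4 ℕ.+ k)} → NonStar T → Σ[ Q ∈ Tree (4 ℕ.+ k) ] NonStar₅ Q × T ⊑ Q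
toNonStar₅ (more {p = zero} path)                   = _ , base zero , ⊑-refl
toNonStar₅ (more {p = suc zero} path)               = _ , base (suc zero) , ⊑-refl
toNonStar₅ (more {p = suc (suc zero)} path)         = _ , base (suc zero) , ⊑-leaf P₄-reverse
toNonStar₅ (more {p = suc (suc (suc zero))} path)   = _ , base zero , ⊑-leaf P₄-reverse
toNonStar₅ {zero} (more (more (more (more ()))))
toNonStar₅ {suc k} (more (more n)) = let Q , q , s = toNonStar₅ {k} (more n) in _ , more q , ⊑-leaf s

TwoLeaves : ∀ {k} → Tree (suc (suc k)) → Set
TwoLeaves {k} T = Σ[ U ∈ Tree k ] Σ[ p ∈ Fin (suc k) ] Σ[ q ∈ Fin (suc k) ] p ≢ q × T ⊑ leaf (leaf U p) (suc q)

-- When one more leaf is attached to one of the two leaves, it replaces that leaf, which joins the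
-- remaining tree `U`; attached anywhere else, it joins `U` itself. The two parents stay different
-- in each case.
twoLeaves : ∀ {k} {T : Tree (suc (suc k))} → NonStar T → TwoLeaves T
twoLeaves path = leaf root zero , # 1 , # 0 , (λ ()) ,
  record { ψ = ψ′ ; ψ-inj = λ {x} {y} → inj x y
         ; ψ-edge = λ { zero → # 0 , inj₁ (refl , refl) ; (suc zero) → # 2 , inj₁ (refl , refl)
                      ; (suc (suc zero)) → # 1 , inj₂ (refl , refl) } }
  where
  ψ′ : Fin 4 → Fin 4
  ψ′ zero                   = # 0
  ψ′ (suc zero)             = # 2
  ψ′ (suc (suc zero))       = # 3
  ψ′ (suc (suc (suc zero))) = # 1
  inj : ∀ x y → ψ′ x ≡ ψ′ y → x ≡ y
  inj = from-yes (all? λ x → all? λ y → (ψ′ x ≟ ψ′ y) →-dec (x ≟ y))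
twoLeaves {zero} (more (more ()))
twoLeaves {suc k} (more {p = r} n) = let U , p , q , p≢q , s = twoLeaves n in go U p q p≢q s
  where
  go : ∀ {T} U p q → p ≢ q → T ⊑ leaf (leaf U p) (suc q) → TwoLeaves (leaf T r)
  go U p q p≢q s with ψ s r in eq
  ... | zero = leaf U q , suc p , zero , (λ ()) , ⊑-trans (⊑-leaf s)
    (subst (λ x → leaf _ x ⊑ _) (sym eq) (⊑-leaf ⊑-swap))
  ... | suc zero = leaf U p , suc q , zero , (λ ()) , ⊑-trans (⊑-leaf s)
    (subst (λ x → leaf _ x ⊑ _) (sym eq) ⊑-refl)
  ... | suc (suc x) = leaf U x , suc p , suc q , (p≢q ∘ suc-injective) , ⊑-trans (⊑-leaf s)
    (subst (λ x → leaf _ x ⊑ _) (sym eq) (⊑-trans ⊑-swap (⊑-leaf ⊑-swap)))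

joined? : ∀ {k} (T : Tree k) x y → Dec (Joined T x y)
joined? T x y = any? λ j → ((x ≟ inject₁ j) ×-dec (y ≟ par T j)) ⊎-dec ((y ≟ inject₁ j) ×-dec (x ≟ par T j))

Joined-unleaf : ∀ {k} {T : Tree k} {p x y} → Joined (leaf T p) (suc x) (suc y) → Joined T x y
Joined-unleaf (suc j , inj₁ (a , b)) = j , inj₁ (suc-injective a , suc-injective b)
Joined-unleaf (suc j , inj₂ (a , b)) = j , inj₂ (suc-injective a , suc-injective b)
Joined-unleaf (zero , inj₁ (() , _))
Joined-unleaf (zero , inj₂ (() , _))

Joined-zero : ∀ {k} {T : Tree k} {p x} → Joined (leaf T p) zero x → x ≡ suc p
Joined-zero (zero , inj₁ (_ , e)) = e
Joined-zero (zero , inj₂ (_ , ()))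
Joined-zero (suc j , inj₁ (() , _))
Joined-zero (suc j , inj₂ (_ , ()))

otherThan : ∀ {k} (p : Fin (suc (suc k))) → ∃ λ q → q ≢ p
otherThan zero    = suc zero , λ ()
otherThan (suc p) = zero , λ ()

-- The centre of a star has no such vertex; `OnePartner` depends on non-stars for this reason.
nonNeighbour : ∀ {k} {T : Tree k} → NonStar T → ∀ p → ∃ λ z → z ≢ p × ¬ Joined T p z
nonNeighbour path = from-yes (all? λ p → any? λ z → ¬? (z ≟ p) ×-dec ¬? (joined? P₄ p z))
nonNeighbour (more n) (suc p) = let z , ne , nj = nonNeighbour n p in
  suc z , ne ∘ suc-injective , nj ∘ Joined-unleaf
nonNeighbour {suc (suc k)} (more {p = p} n) zero = let q , ne = otherThan p in
  suc q , (λ ()) , ne ∘ suc-injective ∘ Joined-zero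

-- Permutations and counting

avoid : ∀ {m n} → m ℕ.< n → (f : Fin m → Fin n) → ∃ λ z → ∀ i → f i ≢ z
avoid {m} {n} m<n f with any? (λ z → all? λ i → ¬? (f i ≟ z))
... | yes r = r
... | no ¬r = ⊥-elim (i≢j (trans (sym (proj₂ (hit i))) (trans (cong f gi≡gj) (proj₂ (hit j)))))
  where
  hit : ∀ z → ∃ λ i → f i ≡ z
  hit z with any? (λ i → f i ≟ z)
  ... | yes h = h
  ... | no ¬h = ⊥-elim (¬r (z , λ i e → ¬h (i , e)))
  ph = pigeonhole m<n (proj₁ ∘ hit)
  i = proj₁ ph
  j = proj₁ (proj₂ ph)
  i≢j : i ≢ j
  i≢j e = ℕ.<-irrefl (cong toℕ e) (proj₁ (proj₂ (proj₂ ph)))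
  gi≡gj = proj₂ (proj₂ (proj₂ ph))

injective⇒surjective : ∀ {n} (f : Fin n → Fin n) → (∀ {x y} → f x ≡ f y → x ≡ y) → ∀ y → ∃ λ x → f x ≡ y
injective⇒surjective {suc n} f inj y with any? (λ x → f x ≟ y)
... | yes r = r
... | no ¬r = let i , j , i<j , e = pigeonhole ℕ.≤-refl (λ x → punchOut (miss x)) in
  ⊥-elim (ℕ.<-irrefl (cong toℕ (inj (punchOut-injective (miss i) (miss j) e))) i<j)
  where
  miss : ∀ x → y ≢ f x
  miss x e = ¬r (x , sym e)

sequence : ∀ {n} {D : Set} {P : Fin n → Set} → (∀ i → D ⊎ P i) → D ⊎ (∀ i → P i)
sequence {zero}  f = inj₂ λ ()
sequence {suc n} f with f zero | sequence (f ∘ suc)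
... | inj₁ d | _      = inj₁ d
... | inj₂ p | inj₁ d = inj₁ d
... | inj₂ p | inj₂ q = inj₂ λ { zero → p ; (suc i) → q i }

Perm : ℕ → Set
Perm n = Σ[ π ∈ (Fin n → Fin n) ] (∀ {x y} → π x ≡ π y → x ≡ y)

place : ∀ {n} (i b : Fin (suc n)) → Perm n → Perm (suc n)
place {n} i b (π , π-inj) = σ , λ {x} {y} → inj x y
  where
  σ = insertAt (punchIn b ∘ π) i b
  inj : ∀ x y → σ x ≡ σ y → x ≡ y
  inj x y e with atOrIn i x | atOrIn i y
  ... | at | at = refl
  ... | at | in′ l rewrite insertAt-lookup (punchIn b ∘ π) i b | insertAt-punchIn (punchIn b ∘ π) i b l =
    ⊥-elim (punchInᵢ≢i b _ (sym e))
  ... | in′ j | at rewrite insertAt-lookup (punchIn b ∘ π) i b | insertAt-punchIn (punchIn b ∘ π) i b j =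
    ⊥-elim (punchInᵢ≢i b _ e)
  ... | in′ j | in′ l rewrite insertAt-punchIn (punchIn b ∘ π) i b j | insertAt-punchIn (punchIn b ∘ π) i b l =
    cong (punchIn i) (π-inj (punchIn-injective b _ _ e))

place-at : ∀ {n} (i b : Fin (suc n)) (π : Perm n) → proj₁ (place i b π) i ≡ b
place-at i b π = insertAt-lookup _ i b

place-in : ∀ {n} (i b : Fin (suc n)) (π : Perm n) j → proj₁ (place i b π) (punchIn i j) ≡ punchIn b (proj₁ π j)
place-in i b π j = insertAt-punchIn _ i b j

idPerm : ∀ {n} → Perm n
idPerm = id , id

placeTwo : ∀ {n} {i j b c : Fin (suc (suc n))} → i ≢ j → b ≢ c → Perm n → Perm (suc (suc n))
placeTwo {i = i} {b = b} i≢j b≢c π = place i b (place (punchOut i≢j) (punchOut b≢c) π)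

module _ {n} {i j b c : Fin (suc (suc n))} (i≢j : i ≢ j) (b≢c : b ≢ c) (π : Perm n) where
  private σ = proj₁ (placeTwo i≢j b≢c π)

  placeTwo-1 : σ i ≡ b
  placeTwo-1 = place-at i b (place (punchOut i≢j) (punchOut b≢c) π)

  placeTwo-2 : σ j ≡ c
  placeTwo-2 = trans (cong σ (sym (punchIn-punchOut i≢j)))
    (trans (place-in i b (place (punchOut i≢j) (punchOut b≢c) π) (punchOut i≢j))
    (trans (cong (punchIn b) (place-at (punchOut i≢j) (punchOut b≢c) π)) (punchIn-punchOut b≢c)))

  placeTwo-in : ∀ l → σ (punchIn i (punchIn (punchOut i≢j) l)) ≡ punchIn b (punchIn (punchOut b≢c) (proj₁ π l))
  placeTwo-in l = trans (place-in i b (place (punchOut i≢j) (punchOut b≢c) π) _)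
    (cong (punchIn b) (place-in (punchOut i≢j) (punchOut b≢c) π l))

extend₃ : ∀ {n} {a b c : Fin (3 ℕ.+ n)} → a ≢ b → a ≢ c → b ≢ c →
          Σ[ π ∈ Perm (3 ℕ.+ n) ] proj₁ π (# 0) ≡ a × proj₁ π (# 1) ≡ b × proj₁ π (# 2) ≡ c
extend₃ {a = a} ab ac bc =
  place (# 0) a π , place-at (# 0) a π
  , trans (place-in (# 0) a π (# 0))
      (trans (cong (punchIn a) (placeTwo-1 {i = # 0} {j = # 1} (λ ()) bc′ idPerm)) (punchIn-punchOut ab))
  , trans (place-in (# 0) a π (# 1))
      (trans (cong (punchIn a) (placeTwo-2 {i = # 0} {j = # 1} (λ ()) bc′ idPerm)) (punchIn-punchOut ac))
  where
  bc′ : punchOut ab ≢ punchOut ac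
  bc′ = bc ∘ punchOut-injective ab ac
  π = placeTwo {i = # 0} {j = # 1} (λ ()) bc′ idPerm

extend₄ : ∀ {n} {a b c d : Fin (4 ℕ.+ n)} → a ≢ b → a ≢ c → a ≢ d → b ≢ c → b ≢ d → c ≢ d →
          Σ[ π ∈ Perm (4 ℕ.+ n) ] proj₁ π (# 0) ≡ a × proj₁ π (# 1) ≡ b × proj₁ π (# 2) ≡ c × proj₁ π (# 3) ≡ d
extend₄ {a = a} ab ac ad bc bd cd =
  let π , e , f , g = extend₃ (bc ∘ punchOut-injective ab ac) (bd ∘ punchOut-injective ab ad)
                              (cd ∘ punchOut-injective ac ad)
      step = λ {x} i (ne : a ≢ x) (h : proj₁ π i ≡ punchOut ne) →
               trans (place-in (# 0) a π i) (trans (cong (punchIn a) h) (punchIn-punchOut ne))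
  in place (# 0) a π , place-at (# 0) a π , step (# 0) ab e , step (# 1) ac f , step (# 2) ad g

bitℕ : Bool → ℕ
bitℕ true  = 1
bitℕ false = 0

count : ∀ {n} → (Fin n → Bool) → ℕ
count {zero}  A = 0
count {suc n} A = bitℕ (A zero) ℕ.+ count (A ∘ suc)

count-punchIn : ∀ {n} (A : Fin (suc n) → Bool) i → count A ≡ bitℕ (A i) ℕ.+ count (A ∘ punchIn i)
count-punchIn         A zero    = refl
count-punchIn {suc n} A (suc i) = trans (cong (bitℕ (A zero) ℕ.+_) (count-punchIn (A ∘ suc) i))
  (x∙yz≈y∙xz (bitℕ (A zero)) (bitℕ (A (suc i))) _)

count-remove : ∀ {n} (A : Fin (suc n) → Bool) i → A i ≡ true → count A ≡ suc (count (A ∘ punchIn i))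
count-remove A i e = trans (count-punchIn A i) (cong (λ b → bitℕ b ℕ.+ count (A ∘ punchIn i)) e)

count-not : ∀ {n} (A : Fin n → Bool) → count A ℕ.+ count (not ∘ A) ≡ n
count-not {zero}  A = refl
count-not {suc n} A with A zero
... | true  = cong suc (count-not (A ∘ suc))
... | false = trans (ℕ.+-suc _ _) (cong suc (count-not (A ∘ suc)))

count-true : ∀ {n} (A : Fin n → Bool) → 1 ℕ.≤ count A → ∃ λ i → A i ≡ true
count-true {suc n} A le with A zero in eq
... | true  = zero , eq
... | false = let i , e = count-true (A ∘ suc) le in suc i , e

≤-subst : ∀ {a b c d : ℕ} → a ≡ b → c ≡ d → a ℕ.≤ c → b ℕ.≤ d
≤-subst refl refl le = le

-- Greedily: a value in `A` is put on a position in `B`, and both are deleted.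
assign : ∀ {n} (A B : Fin n → Bool) → count A ℕ.≤ count B →
         Σ[ π ∈ Perm n ] (∀ i → A (proj₁ π i) ≡ true → B i ≡ true)
assign {zero}  A B le = idPerm , λ ()
assign {suc n} A B le with any? (λ x → A x Bool.≟ true)
... | no ¬a = idPerm , λ i e → ⊥-elim (¬a (i , e))
... | yes (x , ax) with count-true B (ℕ.≤-trans (subst (1 ℕ.≤_) (sym (count-remove A x ax)) (ℕ.s≤s ℕ.z≤n)) le)
...   | i , bi with assign (A ∘ punchIn x) (B ∘ punchIn i)
                  (ℕ.s≤s⁻¹ (≤-subst (count-remove A x ax) (count-remove B i bi) le))
...     | π , ok = place i x π , ok′
  where
  ok′ : ∀ j → A (proj₁ (place i x π) j) ≡ true → B j ≡ true
  ok′ j e with atOrIn i j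
  ... | at = bi
  ... | in′ l = ok l (trans (cong A (sym (place-in i x π l))) e)

-- Pure pairs

Pure : ∀ {N} → Col N → Colour → Fin N → Fin N → Set
Pure χ c x y = x ≢ y × (∀ z → z ≢ x → z ≢ y → χ x y z ≡ c)

TwoThirds : ∀ {N} → Col N → Colour → Fin N → Fin N → Set
TwoThirds χ c x y = ∃₂ λ z z′ → z ≢ z′ × Third χ c x y z × Third χ c x y z′

module _ {N : ℕ} (χ : Col N) where

  abstract
   pure? : ∀ c x y → Dec (Pure χ c x y)
   pure? c x y = ¬? (x ≟ y) ×-dec all? (λ z → ¬? (z ≟ x) →-dec (¬? (z ≟ y) →-dec (χ x y z ≟ᶜ c)))

  pure-or-third : ∀ c {x y} → x ≢ y → Pure χ (opp c) x y ⊎ ∃ (Third χ c x y)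
  pure-or-third c {x} {y} x≢y with any? (Search.third? χ c x y)
  ... | yes t = inj₂ t
  ... | no ¬t = inj₁ (x≢y , λ z z≢x z≢y → ≢→opp λ e → ¬t (z , z≢x , z≢y , e))

  hall₂ : ∀ {k c} (T : Tree k) (φ : Fin (suc k) → Fin N) → (∀ {x y} → φ x ≡ φ y → x ≡ y) →
          (∀ j → TwoThirds χ c (φ (inject₁ j)) (φ (par T j))) → Berge χ c T
  hall₂ T φ φ-inj tt = hall T φ φ-inj (proj₁ ∘ tt) (λ j → proj₁ (proj₂ (tt j)))
    (λ j → proj₁ (proj₂ (proj₂ (proj₂ (tt j))))) (λ j → proj₂ (proj₂ (proj₂ (proj₂ (tt j)))))
    (λ {_} {_} {j} _ _ _ _ → proj₁ (proj₂ (proj₂ (tt j))))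

module _ {N : ℕ} {χ : Col N} (χ-sym : Symmetric χ) where

  third-sym : ∀ {c x y z} → Third χ c x y z → Third χ c y x z
  third-sym (a , b , e) = b , a , trans (swap₁ χ-sym _ _ _) e

  twoThirds-sym : ∀ {c x y} → TwoThirds χ c x y → TwoThirds χ c y x
  twoThirds-sym (z , z′ , ne , t , t′) = z , z′ , ne , third-sym t , third-sym t′

  pure-sym : ∀ {c x y} → Pure χ c x y → Pure χ c y x
  pure-sym (ne , p) = ≢-sym ne , λ z a b → trans (swap₁ χ-sym _ _ _) (p z b a)

  pure-colour : ∀ {c u v x y z} → Pure χ c u v → u ∈₃ (x , y , z) → v ∈₃ (x , y , z) →
                x ≢ y → z ≢ x → z ≢ y → χ x y z ≡ c
  pure-colour (ne , p) (1st refl) (1st refl) xy zx zy = ⊥-elim (ne refl)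
  pure-colour (ne , p) (2nd refl) (2nd refl) xy zx zy = ⊥-elim (ne refl)
  pure-colour (ne , p) (3rd refl) (3rd refl) xy zx zy = ⊥-elim (ne refl)
  pure-colour (ne , p) (1st refl) (2nd refl) xy zx zy = p _ zx zy
  pure-colour (ne , p) (2nd refl) (1st refl) xy zx zy = trans (swap₁ χ-sym _ _ _) (p _ zy zx)
  pure-colour (ne , p) (1st refl) (3rd refl) xy zx zy = trans (swap₂ χ-sym _ _ _) (p _ (≢-sym xy) (≢-sym zy))
  pure-colour (ne , p) (3rd refl) (1st refl) xy zx zy =
    trans (sym (rot χ-sym _ _ _)) (p _ (≢-sym zy) (≢-sym xy))
  pure-colour (ne , p) (2nd refl) (3rd refl) xy zx zy = trans (rot χ-sym _ _ _) (p _ xy (≢-sym zx))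
  pure-colour (ne , p) (3rd refl) (2nd refl) xy zx zy =
    trans (rot χ-sym _ _ _) (trans (swap₁ χ-sym _ _ _) (p _ (≢-sym zx) xy))

  -- The way in which pure pairs supply triples: a partner of `x` completes every other pair
  -- containing `x`.
  pure-third : ∀ {c x y z} → Pure χ c x z → y ≢ x → y ≢ z → Third χ c x y z
  pure-third p yx yz = ≢-sym (proj₁ p) , ≢-sym yz , trans (swap₂ χ-sym _ _ _) (proj₂ p _ yx yz)

  pure-conflict : ∀ {c x y z} → 2 ℕ.< N → Pure χ c x y → Pure χ (opp c) x z → ⊥
  pure-conflict {c} {x} {y} {z} 2<N p q with y ≟ z
  ... | no y≢z = opp≢ c (trans (sym (proj₂ p z (≢-sym (proj₁ q)) (≢-sym y≢z)))
                               (trans (swap₂ χ-sym _ _ _) (proj₂ q y (≢-sym (proj₁ p)) y≢z)))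
  ... | yes refl = let w , ne = avoid 2<N (lookup (x ∷ y ∷ [])) in
    opp≢ c (trans (sym (proj₂ p w (≢-sym (ne (# 0))) (≢-sym (ne (# 1)))))
                  (proj₂ q w (≢-sym (ne (# 0))) (≢-sym (ne (# 1)))))

  pure-twoThirds : ∀ {c x y} → 3 ℕ.< N → Pure χ c x y → TwoThirds χ c x y
  pure-twoThirds {x = x} {y} 3<N (ne , p) =
    let w , a = avoid (ℕ.<-trans ℕ.≤-refl 3<N) (lookup (x ∷ y ∷ []))
        v , b = avoid 3<N (lookup (x ∷ y ∷ w ∷ []))
        third = λ {z} (zx : z ≢ x) (zy : z ≢ y) → zx , zy , p z zx zy
    in w , v , b (# 2) , third (≢-sym (a (# 0))) (≢-sym (a (# 1))) , third (≢-sym (b (# 0))) (≢-sym (b (# 1)))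

twoOthers : ∀ {N} → 4 ℕ.< N → (x y w : Fin N) →
            ∃₂ λ z z′ → z ≢ z′ × (z ≢ x × z ≢ y × z ≢ w) × (z′ ≢ x × z′ ≢ y × z′ ≢ w)
twoOthers 4<N x y w =
  let z , a = avoid (ℕ.<-trans ℕ.≤-refl 4<N) (lookup (x ∷ y ∷ w ∷ []))
      z′ , b = avoid 4<N (lookup (x ∷ y ∷ w ∷ z ∷ []))
  in z , z′ , b (# 3) , (≢-sym (a (# 0)) , ≢-sym (a (# 1)) , ≢-sym (a (# 2)))
                      , (≢-sym (b (# 0)) , ≢-sym (b (# 1)) , ≢-sym (b (# 2)))

-- Five vertices, and two stars on six vertices

relative : Colour → Colour → Colour
relative c d = if does (d ≟ᶜ c) then blue else red

relative-blue : ∀ {c d} → relative c d ≡ blue → d ≡ c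
relative-blue {c} {d} e with d ≟ᶜ c
... | yes p = p
relative-blue () | no _

relative-red : ∀ {c d} → relative c d ≡ red → d ≡ opp c
relative-red {c} {d} e with d ≟ᶜ c
... | no ne = ≢→opp ne
relative-red () | yes _

blues-relative : ∀ {n} c (f : Fin n → Colour) →
                 blues (tabulate (relative c ∘ f)) ℕ.+ blues (tabulate (relative (opp c) ∘ f)) ≡ n
blues-relative {zero}  c f = refl
blues-relative {suc n} c f with c | f zero | blues-relative c (f ∘ suc)
... | blue | blue | h = cong suc h
... | blue | red  | h = trans (ℕ.+-suc _ _) (cong suc h)
... | red  | blue | h = trans (ℕ.+-suc _ _) (cong suc h)
... | red  | red  | h = cong suc h

module _ (χ : Col 5) (χ-sym : Symmetric χ) where

  private
    colours : Fin 10 → Colour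
    colours i = let x , y , z = lookup cotriples i in χ x y z

    v : Colour → Vec Colour 10
    v c = tabulate (relative c ∘ colours)

    toχ : ∀ {k c} {T : Tree k} → Berge (colouring₅ (v c)) blue T → Berge χ c T
    toχ {c = c} = recolour id id λ {x} {y} {z} xy zx zy e → case cotriple-correct x y z of λ where
      (inj₁ (1st e)) → ⊥-elim (xy e)
      (inj₁ (2nd e)) → ⊥-elim (zx e)
      (inj₁ (3rd e)) → ⊥-elim (zy e)
      (inj₂ (s , _)) → trans (colour-⊆ χ-sym xy (≢-sym zx) (≢-sym zy) s)
        (relative-blue (trans (sym (lookup∘tabulate (relative c ∘ colours)
                                     (pairIndex (31 ℕ.∸ (2^ x ℕ.+ (2^ y ℕ.+ 2^ z)))))) e))

    five : ∀ c → 5 ℕ.≤ blues (v c) →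
           (∀ i → Berge χ c (nonStar₅ i)) × (6 ℕ.≤ blues (v c) → Berge χ c (star 4))
    five c le = let all , st = five-triples (v c) le in toχ ∘ all , toχ ∘ st

    nonStars : ∀ {c} {T : Tree 4} → NonStar T → (∀ i → Berge χ c (nonStar₅ i)) → Berge χ c T
    nonStars n all = case toNonStar₅ {0} n of λ where
      (_ , base i , s) → ⊑-berge χ-sym s (all i)
      (_ , more (more (more (more ()))) , _)

    -- Of the ten triples, six have colour `c` or at least five have the other one. A split into
    -- five and five need not give a star, so a star is only paired with a non-star here.
    dichotomy : ∀ c → ((∀ i → Berge χ c (nonStar₅ i)) × Berge χ c (star 4))
                      ⊎ (∀ i → Berge χ (opp c) (nonStar₅ i))
    dichotomy c with 6 ℕ.≤? blues (v c)
    ... | yes le = let all , st = five c (ℕ.≤-trans (ℕ.n≤1+n 5) le) in inj₁ (all , st le)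
    ... | no ¬le = inj₂ (proj₁ (five (opp c) (ℕ.+-cancelˡ-≤ 5 5 (blues (v (opp c))) (ℕ.≤-trans
      (ℕ.≤-reflexive (sym (blues-relative c colours))) (ℕ.+-monoˡ-≤ (blues (v (opp c))) (ℕ.s≤s⁻¹ (ℕ.≰⇒> ¬le)))))))

  base-nonStar : ∀ {T T′ : Tree 4} c → NonStar T → NonStar T′ → Berge χ c T ⊎ Berge χ (opp c) T′
  base-nonStar c n n′ = Sum.map (nonStars n ∘ proj₁) (nonStars n′) (dichotomy c)

  base-star : ∀ {T′ : Tree 4} c → NonStar T′ → Berge χ c (star 4) ⊎ Berge χ (opp c) T′
  base-star c n′ = Sum.map proj₂ (nonStars n′) (dichotomy c)

module _ (χ : Col 6) (χ-sym : Symmetric χ) (no-pure : ∀ c y → ¬ Pure χ c zero y) where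

  private
    colours : Fin 10 → Colour
    colours i = let x , y = lookup pairs i in χ zero (suc x) (suc y)

    v : Colour → Vec Colour 10
    v c = tabulate (relative c ∘ colours)

    index = λ x y → pairIndex (2^ x ℕ.+ 2^ y)

    colours-index : ∀ {x y} → x ≢ y → colours (index x y) ≡ χ zero (suc x) (suc y)
    colours-index {x} {y} ne with pairIndex-correct x y
    ... | 1st e = ⊥-elim (ne e)
    ... | 2nd e rewrite e = refl
    ... | 3rd e rewrite e = swap₂ χ-sym _ _ _

    lookup-v : ∀ {x y} c → x ≢ y → lookup (v c) (index x y) ≡ relative c (χ zero (suc x) (suc y))
    lookup-v {x} {y} c ne =
      trans (lookup∘tabulate (relative c ∘ colours) (index x y)) (cong (relative c) (colours-index ne))

    toχ : ∀ {k c} {T : Tree k} → Berge (link₆ (v c)) blue T → Berge χ c T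
    toχ {c = c} = recolour id id λ
      { {suc x} {zero} {suc z} xy zx zy e → trans (swap₁ χ-sym _ _ _)
          (relative-blue (trans (sym (lookup-v c (zx ∘ cong suc ∘ sym))) e)) }

    star₆ : ∀ c → 5 ℕ.≤ blues (v c) → Berge χ c (star 5)
    star₆ c le with five-edges (v c) le
    ... | inj₂ B = toχ B
    -- A vertex isolated in the graph of colour `c` on the link of 0 forms a pure pair of the other
    -- colour with 0.
    ... | inj₁ (x , mono) = ⊥-elim (no-pure (opp c) (suc x) ((λ ()) , pure))
      where
      pure : ∀ z → z ≢ zero → z ≢ suc x → χ zero (suc x) z ≡ opp c
      pure zero    ne _  = ⊥-elim (ne refl)
      pure (suc z) _  ne = [ (λ e → ⊥-elim (x≢z e))
                           , (λ e → relative-red (trans (sym (lookup-v c x≢z)) e)) ]′ (mono z)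
        where
        x≢z : x ≢ z
        x≢z e = ne (cong suc (sym e))

  star-star₆ : ∀ c → Berge χ c (star 5) ⊎ Berge χ (opp c) (star 5)
  star-star₆ c with 5 ℕ.≤? blues (v c)
  ... | yes le = inj₁ (star₆ c le)
  ... | no ¬le = inj₂ (star₆ (opp c) (ℕ.+-cancelˡ-≤ 5 5 (blues (v (opp c))) (ℕ.≤-trans
      (ℕ.≤-reflexive (sym (blues-relative c colours)))
      (ℕ.+-monoˡ-≤ (blues (v (opp c))) (ℕ.≤-trans (ℕ.s≤s⁻¹ (ℕ.≰⇒> ¬le)) (ℕ.n≤1+n 4))))))

-- Transfer of the computed patterns to arbitrary colourings

contains₆-nonStar : ∀ P {Q : Tree 5} → contains₆ P ≡ true → NonStar₅ Q → Berge (spanned P) blue Q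
contains₆-nonStar P e (more {p = p} (base i)) = Search.found-berge (spanned P) blue (meetsᵇ P) (allFin 6) _
  (allᵇ-true (found i) (allᵇ-true (allᵇ ∘ found) e i) p)
  where
  found = λ i p → Search.found (spanned P) blue (meetsᵇ P) (allFin 6) (leaf (nonStar₅ i) p)
contains₆-nonStar P e (more (more (more (more (more ())))))

contains₇-nonStar : ∀ P {Q : Tree 6} → contains₇ P ≡ true → NonStar₅ Q → Berge (spanned P) blue Q
contains₇-nonStar P e (more {p = q} (more {p = p} (base i))) =
  Search.found-berge (spanned P) blue (meetsᵇ P) (allFin 7) _
  (allᵇ-true (found i p) (allᵇ-true (allᵇ ∘ found i) (allᵇ-true (λ i → allᵇ (allᵇ ∘ found i)) e i) p) q)
  where
  found = λ i p q → Search.found (spanned P) blue (meetsᵇ P) (allFin 7) (leaf (leaf (nonStar₅ i) p) q)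
contains₇-nonStar P e (more (more (more (more (more (more ()))))))

has-true : ∀ {N} (w : Fin N) t → has w t ≡ true → w ∈₃ t
has-true w t = does-true (∈₃? _≟_ w t)

if-blue : ∀ b → (if b then blue else red) ≡ blue → b ≡ true
if-blue true e = refl

∈₃-map : {A B : Set} (f : A → B) {w : A} (t : Tri A) → w ∈₃ t → let x , y , z = t in f w ∈₃ (f x , f y , f z)
∈₃-map f t (1st e) = 1st (cong f e)
∈₃-map f t (2nd e) = 2nd (cong f e)
∈₃-map f t (3rd e) = 3rd (cong f e)

spanned-berge : ∀ {N k} {χ : Col N} {c} {T : Tree k} → Symmetric χ → ∀ P (π : Perm N) →
                All (λ (u , w) → Pure χ c (proj₁ π u) (proj₁ π w)) P → Berge (spanned P) blue T → Berge χ c T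
spanned-berge {N} {χ = χ} {c} χ-sym P (π , π-inj) pures =
  recolour π π-inj λ {x} {y} {z} xy zx zy e → go pures xy zx zy (if-blue (meets P (x , y , z)) e)
  where
  go : ∀ {P x y z} → All (λ (u , w) → Pure χ c (π u) (π w)) P → x ≢ y → z ≢ x → z ≢ y →
       meets P (x , y , z) ≡ true → χ (π x) (π y) (π z) ≡ c
  go {(u , w) ∷ P} {x} {y} {z} (p ∷ ps) xy zx zy e with ∨-true (has u (x , y , z) ∧ has w (x , y , z)) _ e
  ... | inj₂ e′ = go ps xy zx zy e′
  ... | inj₁ e′ = let eu , ew = ∧-true (has u (x , y , z)) _ e′ in
    pure-colour χ-sym p (∈₃-map π (x , y , z) (has-true u _ eu)) (∈₃-map π (x , y , z) (has-true w _ ew))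
      (xy ∘ π-inj) (zx ∘ π-inj) (zy ∘ π-inj)

module _ {N : ℕ} {χ : Col (4 ℕ.+ N)} (χ-sym : Symmetric χ) {c : Colour} where

  private
    pure≡ : ∀ {a b a′ b′} → Pure χ c a b → a′ ≡ a → b′ ≡ b → Pure χ c a′ b′
    pure≡ p refl refl = p

  path₃-berge : ∀ {k} {T : Tree k} {a b d} → Pure χ c a b → Pure χ c a d → b ≢ d →
                Berge (spanned path₃) blue T → Berge χ c T
  path₃-berge p q bd = let π , e₀ , e₁ , e₂ = extend₃ (proj₁ p) (proj₁ q) bd in
    spanned-berge χ-sym path₃ π (pure≡ p e₀ e₁ ∷ pure≡ q e₀ e₂ ∷ [])

  star₄-berge : ∀ {k} {T : Tree k} {a b d f} → Pure χ c a b → Pure χ c a d → Pure χ c a f →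
                b ≢ d → b ≢ f → d ≢ f → Berge (spanned star₄) blue T → Berge χ c T
  star₄-berge p q r bd bf df = let π , e₀ , e₁ , e₂ , e₃ = extend₄ (proj₁ p) (proj₁ q) (proj₁ r) bd bf df in
    spanned-berge χ-sym star₄ π (pure≡ p e₀ e₁ ∷ pure≡ q e₀ e₂ ∷ pure≡ r e₀ e₃ ∷ [])

  matching₄-berge : ∀ {k} {T : Tree k} {a b d f} → Pure χ c a b → Pure χ c d f →
                    a ≢ d → a ≢ f → b ≢ d → b ≢ f → Berge (spanned matching₄) blue T → Berge χ c T
  matching₄-berge p q ad af bd bf = let π , e₀ , e₁ , e₂ , e₃ = extend₄ (proj₁ p) ad af bd bf (proj₁ q) in
    spanned-berge χ-sym matching₄ π (pure≡ p e₀ e₁ ∷ pure≡ q e₂ e₃ ∷ [])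

path₃-nonStar : ∀ {Q : Tree 5} → NonStar₅ Q → Berge (spanned {6} path₃) blue Q
path₃-nonStar = contains₆-nonStar (path₃ {2}) path₃-contains₆

matching₄-nonStar₆ : ∀ {Q : Tree 5} → NonStar₅ Q → Berge (spanned {6} matching₄) blue Q
matching₄-nonStar₆ = contains₆-nonStar (matching₄ {2}) matching₄-contains₆

star₄-nonStar : ∀ {Q : Tree 6} → NonStar₅ Q → Berge (spanned {7} star₄) blue Q
star₄-nonStar = contains₇-nonStar (star₄ {3}) star₄-contains₇

matching₄-nonStar₇ : ∀ {Q : Tree 6} → NonStar₅ Q → Berge (spanned {7} matching₄) blue Q
matching₄-nonStar₇ = contains₇-nonStar (matching₄ {3}) matching₄-contains₇

-- Stars

module _ {k : ℕ} (χ : Col (suc k)) (χ-sym : Symmetric χ) {c : Colour} where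

  -- The leaf at `x` takes the triple of `x`, `b` and `t x`. Two leaves x and y share a triple only
  -- if t maps x to y and y to x, so it suffices that `t` has no 2-cycle.
  star-berge : ∀ {b} (t : Fin (suc k) → Fin (suc k)) → (∀ {x} → x ≢ b → Third χ c x b (t x)) →
               (∀ {x} → x ≢ b → t (t x) ≢ x) → Berge χ c (star k)
  star-berge {b} t t-third t∘t = record
    { φ = π ; φ-inj = π-inj ; third = λ j → t (π (inject₁ j))
    ; third≢child = λ j → proj₁ (th j)
    ; third≢parent = λ j e → proj₁ (proj₂ (th j)) (trans e (parent j))
    ; colour = λ j → trans (cong (λ y → χ (π (inject₁ j)) y (t (π (inject₁ j)))) (parent j)) (proj₂ (proj₂ (th j)))
    ; distinct = λ {i} {j} → distinct′ i j }
    where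
    π = proj₁ (place (fromℕ k) b idPerm)
    π-inj = λ {x} {y} → proj₂ (place (fromℕ k) b idPerm) {x} {y}
    parent : ∀ j → π (par (star k) j) ≡ b
    parent j = trans (cong π (par-star k j)) (place-at (fromℕ k) b idPerm)
    child≢ : ∀ j → π (inject₁ j) ≢ b
    child≢ j e = inject₁≢par (star k) j (π-inj (trans e (sym (parent j))))
    th : ∀ j → Third χ c (π (inject₁ j)) b (t (π (inject₁ j)))
    th j = t-third (child≢ j)
    distinct′ : ∀ i j → (π (inject₁ i) , π (par (star k) i) , t (π (inject₁ i)))
                     ≈₃ (π (inject₁ j) , π (par (star k) j) , t (π (inject₁ j))) → i ≡ j
    distinct′ i j ((1st e , _) , _) = inject₁-injective (π-inj e)
    distinct′ i j ((2nd e , _) , _) = ⊥-elim (child≢ i (trans e (parent j)))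
    distinct′ i j ((3rd e , _) , (1st e′ , _)) = inject₁-injective (π-inj (sym e′))
    distinct′ i j ((3rd e , _) , (2nd e′ , _)) = ⊥-elim (child≢ j (trans e′ (parent i)))
    distinct′ i j ((3rd e , _) , (3rd e′ , _)) = ⊥-elim (t∘t (child≢ j) (trans (cong t (sym e)) (sym e′)))

  -- The pure pair lies in only k - 1 triples while the star has k edges, so one triple at `b`
  -- without `b′` is needed. Here `t` permutes b′, x, y cyclically and sends all other leaves to
  -- `b′`, which excludes 2-cycles.
  pure-star : ∀ {b b′ x y} → Pure χ c b b′ → x ≢ y → x ≢ b → x ≢ b′ → y ≢ b → y ≢ b′ → χ b x y ≡ c →
              Berge χ c (star k)
  pure-star {b} {b′} {x} {y} p x≢y x≢b x≢b′ y≢b y≢b′ col = star-berge t t-third t∘t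
    where
    t : Fin (suc k) → Fin (suc k)
    t w with w ≟ b′ | w ≟ x
    ... | yes _ | _     = x
    ... | no _  | yes _ = y
    ... | no _  | no _  = b′
    t-b′ : t b′ ≡ x
    t-b′ with b′ ≟ b′
    ... | yes _ = refl
    ... | no ne = ⊥-elim (ne refl)
    t-third : ∀ {w} → w ≢ b → Third χ c w b (t w)
    t-third {w} w≢b with w ≟ b′ | w ≟ x
    ... | yes refl | _        = x≢b′ , x≢b , trans (swap₁ χ-sym _ _ _) (proj₂ p x x≢b x≢b′)
    ... | no _     | yes refl = ≢-sym x≢y , y≢b , trans (swap₁ χ-sym _ _ _) col
    ... | no w≢b′  | no _     = third-sym χ-sym (pure-third χ-sym p w≢b w≢b′)
    t∘t : ∀ {w} → w ≢ b → t (t w) ≢ w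
    t∘t {w} w≢b e with w ≟ b′ | w ≟ x
    t∘t {w} w≢b e | yes refl | _ with x ≟ b′ | x ≟ x
    ... | yes e′ | _     = x≢b′ e′
    ... | no _   | yes _ = y≢b′ e
    ... | no _   | no ne = ne refl
    t∘t {w} w≢b e | no _ | yes refl with y ≟ b′ | y ≟ x
    ... | yes e′ | _      = y≢b′ e′
    ... | no _   | yes e′ = x≢y (sym e′)
    ... | no _   | no _   = x≢b′ (sym e)
    t∘t {w} w≢b e | no w≢b′ | no w≢x = w≢x (trans (sym e) t-b′)

  abstract
   link? : ∀ b b′ → Dec (∃₂ λ x y → x ≢ y × x ≢ b × x ≢ b′ × y ≢ b × y ≢ b′ × χ b x y ≡ c)
   link? b b′ = any? λ x → any? λ y → ¬? (x ≟ y) ×-dec ¬? (x ≟ b) ×-dec ¬? (x ≟ b′) ×-dec ¬? (y ≟ b)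
                                      ×-dec ¬? (y ≟ b′) ×-dec (χ b x y ≟ᶜ c)

-- Without a star of colour c, all triples containing exactly one of b and b′ have the other
-- colour, so that every pair except {b , b′} lies in two of them.
star-or-tree-pure : ∀ {k} (χ : Col (5 ℕ.+ k)) → Symmetric χ → ∀ {c b b′} → Pure χ c b b′ →
                    (T : Tree (4 ℕ.+ k)) → Berge χ c (star (4 ℕ.+ k)) ⊎ Berge χ (opp c) T
star-or-tree-pure {k} χ χ-sym {c} {b} {b′} p T₀@(leaf (leaf T q′) q)
  with link? χ χ-sym {c} b b′ | link? χ χ-sym {c} b′ b
... | yes (x , y , xy , xb , xb′ , yb , yb′ , col) | _ = inj₁ (pure-star χ χ-sym p xy xb xb′ yb yb′ col)
... | no _ | yes (x , y , xy , xb′ , xb , yb′ , yb , col) =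
  inj₁ (pure-star χ χ-sym (pure-sym χ-sym p) xy xb′ xb yb′ yb col)
... | no ¬l | no ¬l′ = inj₂ (hall₂ χ T₀ π (λ {x} {y} → proj₂ σ {x} {y}) edges)
  where
  -- `b` goes to the last leaf and `b′` to a vertex other than the parent of this leaf, so that no
  -- edge joins the exceptional pair.
  r = proj₁ (otherThan q)
  r≢q = proj₂ (otherThan q)
  σ = placeTwo {i = zero} {j = suc r} (λ ()) (proj₁ p) idPerm
  π = proj₁ σ
  π0 : π zero ≡ b
  π0 = placeTwo-1 {i = zero} {j = suc r} (λ ()) (proj₁ p) idPerm
  π1 : π (suc r) ≡ b′
  π1 = placeTwo-2 {i = zero} {j = suc r} (λ ()) (proj₁ p) idPerm
  off : ∀ {x y} → x ≢ y → x ≢ b → x ≢ b′ → y ≢ b → y ≢ b′ → χ b x y ≡ opp c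
  off xy xb xb′ yb yb′ = ≢→opp λ e → ¬l (_ , _ , xy , xb , xb′ , yb , yb′ , e)
  off′ : ∀ {x y} → x ≢ y → x ≢ b → x ≢ b′ → y ≢ b → y ≢ b′ → χ b′ x y ≡ opp c
  off′ xy xb xb′ yb yb′ = ≢→opp λ e → ¬l′ (_ , _ , xy , xb′ , xb , yb′ , yb , e)
  at-b : ∀ {y} → y ≢ b → y ≢ b′ → TwoThirds χ (opp c) b y
  at-b {y} yb yb′ = let z , z′ , ne , (zb , zb′ , zy) , (z′b , z′b′ , z′y) = twoOthers (ℕ.m≤m+n 5 k) b b′ y in
    z , z′ , ne , (zb , zy , off (≢-sym zy) yb yb′ zb zb′) , (z′b , z′y , off (≢-sym z′y) yb yb′ z′b z′b′)
  at-b′ : ∀ {y} → y ≢ b → y ≢ b′ → TwoThirds χ (opp c) b′ y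
  at-b′ {y} yb yb′ = let z , z′ , ne , (zb , zb′ , zy) , (z′b , z′b′ , z′y) = twoOthers (ℕ.m≤m+n 5 k) b b′ y in
    z , z′ , ne , (zb′ , zy , off′ (≢-sym zy) yb yb′ zb zb′) , (z′b′ , z′y , off′ (≢-sym z′y) yb yb′ z′b z′b′)
  thirds : ∀ x y → x ≢ y → ¬ (x ≡ b × y ≡ b′) → ¬ (x ≡ b′ × y ≡ b) → TwoThirds χ (opp c) x y
  thirds x y xy n n′ with x ≟ b | x ≟ b′ | y ≟ b | y ≟ b′
  ... | yes refl | _ | _ | yes refl = ⊥-elim (n (refl , refl))
  ... | yes refl | _ | _ | no yb′ = at-b (≢-sym xy) yb′
  ... | no _ | yes refl | yes refl | _ = ⊥-elim (n′ (refl , refl))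
  ... | no _ | yes refl | no yb | _ = at-b′ yb (≢-sym xy)
  ... | no xb | no xb′ | yes refl | _ = twoThirds-sym χ-sym (at-b xy xb′)
  ... | no xb | no xb′ | no _ | yes refl = twoThirds-sym χ-sym (at-b′ xb xy)
  ... | no xb | no xb′ | no yb | no yb′ = b , b′ , proj₁ p
    , (≢-sym xb , ≢-sym yb , trans (sym (rot χ-sym _ _ _)) (off xy xb xb′ yb yb′))
    , (≢-sym xb′ , ≢-sym yb′ , trans (sym (rot χ-sym _ _ _)) (off′ xy xb xb′ yb yb′))
  apart : ¬ Joined T₀ zero (suc r)
  apart J = r≢q (suc-injective (Joined-zero J))
  at-ends : ∀ {x y} → Joined T₀ x y → ¬ (π x ≡ b × π y ≡ b′)
  at-ends {x} {y} J (e , e′) =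
    apart (subst₂ (Joined T₀) (proj₂ σ (trans e (sym π0))) (proj₂ σ (trans e′ (sym π1))) J)
  edges : ∀ j → TwoThirds χ (opp c) (π (inject₁ j)) (π (par T₀ j))
  edges j = thirds _ _ (inject₁≢par T₀ j ∘ proj₂ σ) (at-ends (Joined-par T₀ j))
    λ (e , e′) → at-ends (Joined-sym (Joined-par T₀ j)) (e′ , e)

attach : ∀ {N k} {χ : Col (suc N)} {c v} {T : Tree k} (B : Berge (χ ∘₃ punchIn v) c T) p →
         Pure χ (opp c) v (punchIn v (φ B p)) ⊎ Berge χ c (leaf T p)
attach {χ = χ} {c} {v} B p = Sum.map id
  (λ (z , t) → addNew (relabel (punchIn-injective v _ _) B) p
     (relabel-avoids {χ = χ} (punchIn-injective v _ _) B (punchInᵢ≢i v)) t)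
  (pure-or-third χ c (≢-sym (punchInᵢ≢i v (φ B p))))

star-edge-third : ∀ {N k} {χ : Col N} {c} (B : Berge χ c (star k)) i → i ≢ fromℕ k →
                  ∃ (Third χ c (φ B i) (φ B (fromℕ k)))
star-edge-third {k = k} {χ} {c} B i ne with onlyRoot k i ne
  where
  onlyRoot : ∀ k (i : Fin (suc k)) → i ≢ fromℕ k → ∃ λ j → i ≡ inject₁ j
  onlyRoot zero    zero    ne = ⊥-elim (ne refl)
  onlyRoot (suc k) zero    ne = zero , refl
  onlyRoot (suc k) (suc i) ne = let j , e = onlyRoot k i (ne ∘ cong suc) in suc j , cong suc e
... | j , refl = third B j , third≢child B j ,
  subst (λ y → third B j ≢ φ B y × χ (φ B (inject₁ j)) (φ B y) (third B j) ≡ c) (par-star k j)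
        (third≢parent B j , colour B j)

-- If every star of colour c on all but one vertex v has a centre g v that is pure with v, then
-- g v is pure with no other vertex, so g is injective, and g x and g y serve the pair x y.
star-or-tree-impure : ∀ {k} (χ : Col (5 ℕ.+ k)) → Symmetric χ → ∀ {c} → (∀ x y → ¬ Pure χ c x y) →
                      ∀ {T : Tree (3 ℕ.+ k)} {p} → star (3 ℕ.+ k) ⟶ T →
                      Berge χ c (star (4 ℕ.+ k)) ⊎ Berge χ (opp c) (leaf T p)
star-or-tree-impure {k} χ χ-sym {c} impure {T} {p} IH =
  [ id , (λ h → inj₂ (hall₂ χ (leaf T p) id id (edges h))) ]′ (sequence centre)
  where
  Centre : Fin (5 ℕ.+ k) → Set
  Centre v = ∃ λ y → Pure χ (opp c) v y × (∀ u → Pure χ (opp c) u y → u ≡ v)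
  centre : ∀ v → (Berge χ c (star (4 ℕ.+ k)) ⊎ Berge χ (opp c) (leaf T p)) ⊎ Centre v
  centre v with IH (χ ∘₃ punchIn v) (∘₃-symmetric (punchIn v) χ-sym) c
  ... | inj₂ B with attach {χ = χ} B p
  ...   | inj₂ B′ = inj₁ (inj₂ B′)
  ...   | inj₁ pr = ⊥-elim (impure _ _ (subst (λ d → Pure χ d _ _) (opp-opp c) pr))
  centre v | inj₁ B with attach {χ = χ} B (fromℕ (3 ℕ.+ k))
  ...   | inj₂ B′ = inj₁ (inj₁ B′)
  ...   | inj₁ pr = inj₂ (y , pr , only)
    where
    y = punchIn v (φ B (fromℕ (3 ℕ.+ k)))
    -- The star spans all vertices except `v`, so any other `u` is one of its leaves, and the triple
    -- of this leaf contains `u` and the centre and has colour `c`.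
    only : ∀ u → Pure χ (opp c) u y → u ≡ v
    only u (u≢y , pu) with atOrIn v u
    ... | at = refl
    ... | in′ w with injective⇒surjective (φ B) (φ-inj B) w
    ...   | i , refl with star-edge-third B i (λ { refl → u≢y refl })
    ...     | z , z≢i , z≢r , col = ⊥-elim (opp≢ c (trans (sym col)
      (pu (punchIn v z) (z≢i ∘ punchIn-injective v _ _) (z≢r ∘ punchIn-injective v _ _))))
  module _ (h : ∀ v → Centre v) where
    g = λ v → proj₁ (h v)
    pairs′ : ∀ x y → x ≢ y → TwoThirds χ (opp c) x y
    pairs′ x y xy with y ≟ g x | x ≟ g y
    ... | yes refl | _ = pure-twoThirds χ-sym (ℕ.m≤m+n 4 _) (proj₁ (proj₂ (h x)))
    ... | no _ | yes refl = twoThirds-sym χ-sym (pure-twoThirds χ-sym (ℕ.m≤m+n 4 _) (proj₁ (proj₂ (h y))))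
    ... | no y≢gx | no x≢gy = g x , g y
      , (λ e → xy (sym (proj₂ (proj₂ (h x)) y (subst (Pure χ (opp c) y) (sym e) (proj₁ (proj₂ (h y)))))))
      , pure-third χ-sym (proj₁ (proj₂ (h x))) (≢-sym xy) y≢gx
      , third-sym χ-sym (pure-third χ-sym (proj₁ (proj₂ (h y))) xy x≢gy)
    edges : ∀ j → TwoThirds χ (opp c) (inject₁ j) (par (leaf T p) j)
    edges j = pairs′ _ _ (inject₁≢par (leaf T p) j)

abstract
  pure-pair? : ∀ {N} (χ : Col N) c → Dec (∃₂ λ x y → Pure χ c x y)
  pure-pair? χ c = any? λ x → any? λ y → pure? χ c x y

star-step : ∀ {k} {T : Tree (3 ℕ.+ k)} {p} → star (3 ℕ.+ k) ⟶ T → star (4 ℕ.+ k) ⟶ leaf T p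
star-step IH χ χ-sym c with pure-pair? χ c
... | yes (_ , _ , p) = star-or-tree-pure χ χ-sym p _
... | no ¬p = star-or-tree-impure χ χ-sym (λ x y p → ¬p (x , y , p)) IH

⟶-swap : ∀ {k} {T T′ : Tree k} → T ⟶ T′ → T′ ⟶ T
⟶-swap h χ χ-sym c = exchange (h χ χ-sym (opp c))

⟶-⊑ : ∀ {k} {T T′ U U′ : Tree k} → T ⊑ U → T′ ⊑ U′ → U ⟶ U′ → T ⟶ T′
⟶-⊑ s s′ h χ χ-sym c = Sum.map (⊑-berge χ-sym s) (⊑-berge χ-sym s′) (h χ χ-sym c)

star-star-6 : star 5 ⟶ star 5
star-star-6 χ χ-sym c with pure-pair? χ c | pure-pair? χ (opp c)
... | yes (_ , _ , p) | _ = star-or-tree-pure χ χ-sym p (star 5)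
... | no _ | yes (_ , _ , p) =
  exchange (star-or-tree-pure χ χ-sym p (star 5))
... | no ¬p | no ¬p′ = star-star₆ χ χ-sym no-pure c
  where
  no-pure : ∀ d y → ¬ Pure χ d zero y
  no-pure d y q with d ≟ᶜ c
  ... | yes refl = ¬p (_ , _ , q)
  ... | no ne = ¬p′ (_ , _ , subst (λ d → Pure χ d zero y) (≢→opp ne) q)

-- Embeddings along the bipartition

count-cong : ∀ {n} {A B : Fin n → Bool} → (∀ i → A i ≡ B i) → count A ≡ count B
count-cong {zero}  h = refl
count-cong {suc n} h = cong₂ (λ b m → bitℕ b ℕ.+ m) (h zero) (count-cong (h ∘ suc))

count-without : ∀ {n} (A : Fin n → Bool) z → count A ℕ.≤ suc (count (λ x → A x ∧ not (does (z ≟ x))))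
count-without {suc n} A z = ℕ.≤-trans (ℕ.≤-reflexive (count-punchIn A z)) (ℕ.≤-trans
  (ℕ.+-monoˡ-≤ (count (A ∘ punchIn z)) (bit≤1 (A z)))
  (ℕ.s≤s (ℕ.≤-trans (ℕ.≤-reflexive (count-cong same)) (ℕ.≤-trans (ℕ.m≤n+m _ (bitℕ (A′ z)))
    (ℕ.≤-reflexive (sym (count-punchIn A′ z)))))))
  where
  A′ = λ x → A x ∧ not (does (z ≟ x))
  bit≤1 : ∀ b → bitℕ b ℕ.≤ 1
  bit≤1 true  = ℕ.≤-refl
  bit≤1 false = ℕ.z≤n
  same : ∀ i → A (punchIn z i) ≡ A′ (punchIn z i)
  same i with z ≟ punchIn z i
  ... | yes e = ⊥-elim (punchInᵢ≢i z i (sym e))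
  ... | no _ = sym (∧-identityʳ _)

avoidIn : ∀ {m n} (A : Fin n → Bool) → m ℕ.< count A → (f : Fin m → Fin n) → ∃ λ z → A z ≡ true × (∀ i → f i ≢ z)
avoidIn {zero}  A lt f = let z , e = count-true A lt in z , e , λ ()
avoidIn {suc m} A lt f
  with avoidIn (λ x → A x ∧ not (does (f zero ≟ x))) (ℕ.s≤s⁻¹ (ℕ.≤-trans lt (count-without A (f zero)))) (f ∘ suc)
... | z , e , h with f zero ≟ z | ∧-true (A z) _ e
...   | no ne | e₁ , _ = z , e₁ , λ { zero → ne ; (suc i) → h i }

depth-parity : ∀ {k} → Tree k → Fin (suc k) → Bool
depth-parity root       _       = false
depth-parity (leaf T p) zero    = not (depth-parity T p)
depth-parity (leaf T p) (suc x) = depth-parity T x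

depth-parity-par : ∀ {k} (T : Tree k) j → depth-parity T (inject₁ j) ≡ not (depth-parity T (par T j))
depth-parity-par (leaf T p) zero    = refl
depth-parity-par (leaf T p) (suc j) = depth-parity-par T j

Independent : ∀ {k} → Tree k → (Fin (suc k) → Bool) → Set
Independent T B = ∀ j → B (inject₁ j) ≡ true → B (par T j) ≡ true → ⊥

parity-independent : ∀ {k} (T : Tree k) → Independent T (depth-parity T)
parity-independent T j e e′ with trans (sym e) (trans (depth-parity-par T j) (cong not e′))
... | ()

not-parity-independent : ∀ {k} (T : Tree k) → Independent T (not ∘ depth-parity T)
not-parity-independent T j e e′ with trans (sym e) (trans (cong not (depth-parity-par T j)) (cong not e′))
... | ()

-- One of two complementary classes contains at least half of the elements, rounded up; hence
-- `suc n`.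
half : ∀ {n a b m} → a ℕ.+ b ≡ n → m ℕ.+ m ℕ.≤ suc n → m ℕ.≤ a ⊎ m ℕ.≤ b
half {n} {a} {b} {m} e le with m ℕ.≤? a | m ℕ.≤? b
... | yes p | _ = inj₁ p
... | no _ | yes q = inj₂ q
... | no p | no q = ⊥-elim (ℕ.<-irrefl refl
  (ℕ.≤-trans (ℕ.s≤s (ℕ.≤-reflexive (trans (cong suc (sym e)) (sym (ℕ.+-suc a b))))) (ℕ.≤-trans (ℕ.+-mono-≤ (ℕ.≰⇒> p) (ℕ.≰⇒> q)) le)))

module _ {N : ℕ} (χ : Col N) (c : Colour) where

  Covered : Fin N → Set
  Covered x = ∃ (Pure χ c x)

  abstract
   covered? : ∀ x → Dec (Covered x)
   covered? x = any? (pure? χ c x)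

  covered : Fin N → Bool
  covered x = does (covered? x)

  uncovered : Fin N → Bool
  uncovered x = not (covered x)

  covered-true : ∀ {x} → covered x ≡ true → Covered x
  covered-true {x} = does-true (covered? x)

  uncovered-false : ∀ {x} → uncovered x ≢ true → Covered x
  uncovered-false {x} ne with covered? x
  ... | yes p = p
  ... | no _ = ⊥-elim (ne refl)

  covered-uncovered : ∀ {x} → Covered x → uncovered x ≡ false
  covered-uncovered {x} p with covered? x
  ... | yes _ = refl
  ... | no ¬p = ⊥-elim (¬p p)

  Sole : Fin N → Fin N → Set
  Sole x y = Pure χ c x y × (∀ w → Pure χ c x w → w ≡ y)

  abstract
   sole? : ∀ x y → Dec (Sole x y)
   sole? x y = pure? χ c x y ×-dec all? (λ w → pure? χ c x w →-dec (w ≟ y))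

  NoSole : Set
  NoSole = ∀ x y → ¬ Sole x y

  another : ∀ {x y} → Pure χ c x y → ¬ Sole x y → ∃ λ w → Pure χ c x w × w ≢ y
  another {x} {y} p ¬s with any? (λ w → pure? χ c x w ×-dec ¬? (w ≟ y))
  ... | yes r = r
  ... | no ¬r = ⊥-elim (¬s (p , unique))
    where
    unique : ∀ w → Pure χ c x w → w ≡ y
    unique w q with w ≟ y
    ... | yes e = e
    ... | no ne = ⊥-elim (¬r (w , q , ne))

module _ {N : ℕ} {χ : Col N} (χ-sym : Symmetric χ) {c : Colour} where

  shared-twoThirds : ∀ {x y u w} → 3 ℕ.< N → Pure χ c x u → Pure χ c x w → w ≢ u → y ≢ x → TwoThirds χ c x y
  shared-twoThirds {x} {y} {u} {w} 3<N p q w≢u y≢x with y ≟ u | y ≟ w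
  ... | yes refl | _ = pure-twoThirds χ-sym 3<N p
  ... | no _ | yes refl = pure-twoThirds χ-sym 3<N q
  ... | no y≢u | no y≢w = u , w , ≢-sym w≢u , pure-third χ-sym p y≢x y≢u , pure-third χ-sym q y≢x y≢w

-- The uncovered vertices go to an independent set of positions, so that every edge has an end
-- with two pure partners.
noSole-berge : ∀ {k} {χ : Col (suc k)} → Symmetric χ → ∀ {c} → 3 ℕ.< suc k → NoSole χ c →
               count (uncovered χ c) ℕ.≤ count (covered χ c) → (T : Tree k) → Berge χ c T
noSole-berge {k} {χ} χ-sym {c} 3<N ns le T =
  [ build (depth-parity T) (parity-independent T) , build (not ∘ depth-parity T) (not-parity-independent T) ]′
  (half {m = count (uncovered χ c)} (count-not (depth-parity T))
    (ℕ.≤-trans (ℕ.+-monoˡ-≤ _ le) (ℕ.≤-trans (ℕ.≤-reflexive (count-not (covered χ c))) (ℕ.n≤1+n _))))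
  where
  two : ∀ {x y} → Covered χ c x → y ≢ x → TwoThirds χ c x y
  two (u , p) y≢x = let w , q , w≢u = another χ c p (ns _ _) in shared-twoThirds χ-sym 3<N p q w≢u y≢x
  build : ∀ B → Independent T B → count (uncovered χ c) ℕ.≤ count B → Berge χ c T
  build B ind le with assign (uncovered χ c) B le
  ... | (π , π-inj) , ok = hall₂ χ T π π-inj edges
    where
    edges : ∀ j → TwoThirds χ c (π (inject₁ j)) (π (par T j))
    edges j with uncovered χ c (π (inject₁ j)) Bool.≟ true
    ... | no n = two (uncovered-false χ c n) (inject₁≢par T j ∘ sym ∘ π-inj)
    ... | yes e = twoThirds-sym χ-sym (two (uncovered-false χ c λ e′ → ind j (ok _ e) (ok _ e′))
                                           (inject₁≢par T j ∘ π-inj))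

pair-in-pair : ∀ {A : Set} {x y s t e : A} → s ≢ t → s ≢ e → t ≢ e → s ∈₃ (x , y , e) → t ∈₃ (x , y , e) →
               (s ≡ x × t ≡ y) ⊎ (s ≡ y × t ≡ x)
pair-in-pair st se te (1st p) (1st q) = ⊥-elim (st (trans p (sym q)))
pair-in-pair st se te (1st p) (2nd q) = inj₁ (p , q)
pair-in-pair st se te (2nd p) (1st q) = inj₂ (p , q)
pair-in-pair st se te (2nd p) (2nd q) = ⊥-elim (st (trans p (sym q)))
pair-in-pair st se te (3rd p) _       = ⊥-elim (se p)
pair-in-pair st se te (1st _) (3rd q) = ⊥-elim (te q)
pair-in-pair st se te (2nd _) (3rd q) = ⊥-elim (te q)

third-is : ∀ {A : Set} {x y z e : A} → e ≢ x → e ≢ y → e ∈₃ (x , y , z) → z ≡ e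
third-is ex ey (1st p) = ⊥-elim (ex p)
third-is ex ey (2nd p) = ⊥-elim (ey p)
third-is ex ey (3rd p) = sym p

-- Let all vertices with a single pure partner have the partner e, and let d be one of them. Put
-- e at the last leaf of T, d at the parent p of this leaf, and the uncovered vertices at
-- independent positions. The edge e d gets the triple through a vertex whose position is not a
-- neighbour of p, and an edge without an end that has two pure partners gets its triple through
-- e; no other edge lies in one of these triples.
module OnePartner {k : ℕ} {χ : Col (suc (suc k))} (χ-sym : Symmetric χ) {c : Colour} (3<N : 3 ℕ.< suc (suc k))
  {d e : Fin (suc (suc k))} (d-sole : Sole χ c d e) (all-e : ∀ {x y} → Sole χ c x y → y ≡ e)
  {U : Tree k} {p : Fin (suc k)} (n : NonStar (leaf U p)) where

  private
    T = leaf U p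

    e≢d : e ≢ d
    e≢d = ≢-sym (proj₁ (proj₁ d-sole))

    p′ : Fin (suc (suc k))
    p′ = suc p

    0≢p′ : zero ≢ p′
    0≢p′ ()

  module Embed (π : Fin (suc (suc k)) → Fin (suc (suc k))) (π-inj : ∀ {x y} → π x ≡ π y → x ≡ y)
    (π0 : π zero ≡ e) (πp : π p′ ≡ d)
    (ends : ∀ j → Covered χ c (π (inject₁ (suc j))) ⊎ Covered χ c (π (par T (suc j)))) where

    private
      tr = triple T π π-inj

      q : Fin (suc (suc k))
      q = proj₁ (nonNeighbour n p′)

      q≢p′ : q ≢ p′
      q≢p′ = proj₁ (proj₂ (nonNeighbour n p′))

      apart : ¬ Joined T p′ q
      apart = proj₂ (proj₂ (nonNeighbour n p′))

      q≢0 : q ≢ zero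
      q≢0 eq = apart (subst (Joined T p′) (sym eq) (Joined-sym (Joined-new {T = U})))

      π≢e : ∀ {x} → x ≢ zero → π x ≢ e
      π≢e ne eq = ne (π-inj (trans eq (sym π0)))

      record Options (x y : Fin (suc (suc k))) : Set where
        constructor options
        field
          a b     : Fin (suc (suc k))
          a-third : Third χ c x y a
          b-third : Third χ c x y b
          -- An edge with the single option `e` is acceptable because no other edge can use its
          -- triple, by `e-private` and `zero-private`.
          private-or-two : a ≢ b ⊎ (a ≡ e × b ≡ e)

      open Options

      fromTwo : ∀ {x y} → TwoThirds χ c x y → Options x y
      fromTwo (z , z′ , ne , t , t′) = options z z′ t t′ (inj₁ ne)

      viaCovered : ∀ {x y} → Covered χ c x → y ≢ x → x ≢ e → y ≢ e → TwoThirds χ c x y ⊎ Third χ c x y e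
      viaCovered {x} {y} (u , pu) y≢x x≢e y≢e with sole? χ c x u
      ... | yes s with all-e s
      ...   | refl = inj₂ (pure-third χ-sym pu y≢x y≢e)
      viaCovered {x} {y} (u , pu) y≢x x≢e y≢e | no ¬s =
        let w , pw , w≢u = another χ c pu ¬s in inj₁ (shared-twoThirds χ-sym 3<N pu pw w≢u y≢x)

      fromThird : ∀ {x y} → Third χ c x y e → Options x y
      fromThird t = options e e t t (inj₂ (refl , refl))

      opts : ∀ j → Options (π (inject₁ (suc j))) (π (par T (suc j)))
      opts j with ends j
      ... | inj₁ v = [ fromTwo , fromThird ]′
        (viaCovered v (inject₁≢par T (suc j) ∘ sym ∘ π-inj) (π≢e λ ()) (π≢e λ ()))
      ... | inj₂ v = [ fromTwo ∘ twoThirds-sym χ-sym , fromThird ∘ third-sym χ-sym ]′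
        (viaCovered v (inject₁≢par T (suc j) ∘ π-inj) (π≢e λ ()) (π≢e λ ()))

      A B : Fin (suc k) → Fin (suc (suc k))
      A zero    = π q
      A (suc j) = a (opts j)
      B zero    = π q
      B (suc j) = b (opts j)

      zero-third : Third χ c (π zero) (π p′) (π q)
      zero-third = q≢0 ∘ π-inj , q≢p′ ∘ π-inj ,
        trans (cong₂ (λ x y → χ x y (π q)) π0 πp)
          (proj₂ (pure-sym χ-sym (proj₁ d-sole)) (π q) (π≢e q≢0) (λ eq → q≢p′ (π-inj (trans eq (sym πp)))))

      -- `e` sits at position `zero` only, so two other positions in a triple completed by `e` are
      -- the ends of its edge.
      positions : ∀ {i s t z} → π s ∈₃ (π (inject₁ i) , π (par T i) , z) → π t ∈₃ (π (inject₁ i) , π (par T i) , z) →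
                  z ≡ e → s ≢ zero → t ≢ zero → s ≢ t → Join T i s t
      positions hs ht refl s0 t0 st with pair-in-pair (st ∘ π-inj) (π≢e s0) (π≢e t0) hs ht
      ... | inj₁ (a , b) = inj₁ (π-inj a , π-inj b)
      ... | inj₂ (a , b) = inj₂ (π-inj b , π-inj a)

      through-e : ∀ {i z} → e ∈₃ tr (suc i) z → z ≡ e
      through-e = third-is (≢-sym (π≢e λ ())) (≢-sym (π≢e λ ()))

      -- The triple of the last leaf contains `e`, the position `p′` and the position `q`. Another
      -- edge in it would have to join `p′` to `q`.
      zero-private : ∀ {i z} → ¬ tr zero (π q) ≈₃ tr (suc i) z
      zero-private {i} {z} ((h0 , hp , hq) , _) =
        apart (_ , positions {suc i} hp hq (through-e (subst (_∈₃ tr (suc i) z) π0 h0)) (λ ()) q≢0 (≢-sym q≢p′))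

      e-private : ∀ {i j z} → tr (suc i) z ≈₃ tr (suc j) e → i ≡ j
      e-private {i} {j} {z} (_ , (hx , hy , he)) = suc-injective (Join-unique T
        (positions {suc i} hx hy (through-e {i} he) (λ ()) (λ ()) (inject₁≢par T (suc j))) (inj₁ (refl , refl)))

      two : ∀ {i z j z′} → z ≡ A i ⊎ z ≡ B i → z′ ≡ A j ⊎ z′ ≡ B j → i ≢ j → tr i z ≈₃ tr j z′ → A j ≢ B j
      two {zero}  {_} {zero}  _ _ ne _ = ⊥-elim (ne refl)
      two {zero}  {_} {suc j} (inj₁ refl) _ _ t = ⊥-elim (zero-private {j} t)
      two {zero}  {_} {suc j} (inj₂ refl) _ _ t = ⊥-elim (zero-private {j} t)
      two {suc i} {_} {zero}  _ (inj₁ refl) _ t = ⊥-elim (zero-private {i} (≈₃-sym t))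
      two {suc i} {_} {zero}  _ (inj₂ refl) _ t = ⊥-elim (zero-private {i} (≈₃-sym t))
      two {suc i} {z} {suc j} {z′} _ o ne t with private-or-two (opts j)
      ... | inj₁ a≢b = a≢b
      ... | inj₂ (ae , be) = ⊥-elim (ne (cong suc (e-private {i} {j} {z}
                                (subst (λ w → tr (suc i) z ≈₃ tr (suc j) w) (z′≡e o) t))))
        where
        z′≡e : z′ ≡ A (suc j) ⊎ z′ ≡ B (suc j) → z′ ≡ e
        z′≡e (inj₁ h) = trans h ae
        z′≡e (inj₂ h) = trans h be

    embed : Berge χ c T
    embed = hall T π π-inj A B
      (λ { zero → zero-third ; (suc j) → a-third (opts j) })
      (λ { zero → zero-third ; (suc j) → b-third (opts j) })
      (λ {i} {z} {j} {z′} → two {i} {z} {j} {z′})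

  -- `e` and `d` are covered and have fixed positions, which leaves k positions for the uncovered
  -- vertices. If u is their number, the strict inequality gives 2u ≤ k + 1, exactly what `half`
  -- needs on these positions.
  onePartner-berge : count (uncovered χ c) ℕ.< count (covered χ c) → Berge χ c T
  onePartner-berge lt = [ build (depth-parity T) (parity-independent T)
                        , build (not ∘ depth-parity T) (not-parity-independent T) ]′
    (half {m = count (uncovered χ c)} (count-not (depth-parity T ∘ rest)) (ℕ.s≤s⁻¹
      (ℕ.≤-trans (ℕ.+-monoˡ-≤ (count (uncovered χ c)) lt) (ℕ.≤-reflexive (count-not (covered χ c))))))
    where
    rest : Fin k → Fin (suc (suc k))
    rest i = suc (punchIn p i)
    N = uncovered χ c
    N-e : N e ≡ false
    N-e = covered-uncovered χ c (d , pure-sym χ-sym (proj₁ d-sole))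
    N-d : N d ≡ false
    N-d = covered-uncovered χ c (e , proj₁ d-sole)
    N′ : Fin k → Bool
    N′ = N ∘ punchIn e ∘ punchIn (punchOut e≢d)
    count-N : count N ≡ count N′
    count-N = trans (count-punchIn N e) (trans (cong (λ b → bitℕ b ℕ.+ count (N ∘ punchIn e)) N-e)
      (trans (count-punchIn (N ∘ punchIn e) (punchOut e≢d))
             (cong (λ b → bitℕ b ℕ.+ count N′) (trans (cong N (punchIn-punchOut e≢d)) N-d))))
    build : ∀ B → Independent T B → count N ℕ.≤ count (B ∘ rest) → Berge χ c T
    build B ind le with assign N′ (B ∘ rest) (≤-subst count-N refl le)
    ... | σ , ok = Embed.embed π (λ {x} {y} → proj₂ (placeTwo 0≢p′ e≢d σ) {x} {y})
                     (placeTwo-1 0≢p′ e≢d σ) (placeTwo-2 0≢p′ e≢d σ) ends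
      where
      π = proj₁ (placeTwo 0≢p′ e≢d σ)
      ok′ : ∀ x → N (π x) ≡ true → B x ≡ true
      ok′ x h with atOrIn zero x
      ... | at with trans (sym h) (trans (cong N (placeTwo-1 0≢p′ e≢d σ)) N-e)
      ...   | ()
      ok′ x h | in′ y with atOrIn p y
      ... | at with trans (sym h) (trans (cong N (placeTwo-2 0≢p′ e≢d σ)) N-d)
      ...   | ()
      ok′ x h | in′ y | in′ z = ok z (trans (cong N (sym (placeTwo-in 0≢p′ e≢d σ z))) h)
      ends : ∀ j → Covered χ c (π (inject₁ (suc j))) ⊎ Covered χ c (π (par T (suc j)))
      ends j with N (π (inject₁ (suc j))) Bool.≟ true
      ... | no ne = inj₁ (uncovered-false χ c ne)
      ... | yes h = inj₂ (uncovered-false χ c λ h′ → ind (suc j) (ok′ _ h) (ok′ _ h′))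

-- Removing two vertices

AtMostOne : ∀ {N} → Col N → Fin N → Set
AtMostOne χ x = ∀ c {w w′} → Pure χ c x w → Pure χ c x w′ → w ≡ w′

NoCommon : ∀ {N} → Col N → Fin N → Fin N → Set
NoCommon χ x y = ∀ c {w} → Pure χ c x w → ¬ Pure χ c y w

module _ {k : ℕ} {χ : Col (3 ℕ.+ k)} (χ-sym : Symmetric χ) {a b : Fin (3 ℕ.+ k)} (a≢b : a ≢ b)
  (one-a : AtMostOne χ a) (one-b : AtMostOne χ b) (common : NoCommon χ a b) where

  private
    ι : Fin (suc k) → Fin (3 ℕ.+ k)
    ι = punchIn a ∘ punchIn (punchOut a≢b)

    ι-inj : ∀ {x y} → ι x ≡ ι y → x ≡ y
    ι-inj = punchIn-injective (punchOut a≢b) _ _ ∘ punchIn-injective a _ _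

    ι≢a : ∀ x → ι x ≢ a
    ι≢a x = punchInᵢ≢i a _

    ι≢b : ∀ x → ι x ≢ b
    ι≢b x e = punchInᵢ≢i (punchOut a≢b) x (punchIn-injective a _ _ (trans e (sym (punchIn-punchOut a≢b))))

  -- If both ways of attaching a and b were obstructed, then two pure pairs would share a or b
  -- or one of the attachment points.
  addTwoLeaves : ∀ {c} {T : Tree (2 ℕ.+ k)} ((U , _) : TwoLeaves T) → Berge (χ ∘₃ ι) c U → Berge χ c T
  addTwoLeaves {c} (U , p , q , p≢q , s) B₀ = go
    (pure-or-third χ c (≢-sym (ι≢a (φ B₀ p)))) (pure-or-third χ c (≢-sym (ι≢b (φ B₀ q))))
    (pure-or-third χ c (≢-sym (ι≢a (φ B₀ q)))) (pure-or-third χ c (≢-sym (ι≢b (φ B₀ p))))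
    where
    B = relabel {χ = χ} ι-inj B₀
    y = φ B
    a∉ = relabel-avoids {χ = χ} ι-inj B₀ ι≢a
    b∉ = relabel-avoids {χ = χ} ι-inj B₀ ι≢b
    go : Pure χ (opp c) a (y p) ⊎ ∃ (Third χ c a (y p)) → Pure χ (opp c) b (y q) ⊎ ∃ (Third χ c b (y q)) →
         Pure χ (opp c) a (y q) ⊎ ∃ (Third χ c a (y q)) → Pure χ (opp c) b (y p) ⊎ ∃ (Third χ c b (y p)) →
         Berge χ c _
    go (inj₂ (_ , t)) (inj₂ (_ , t′)) _ _ = ⊑-berge χ-sym s (addTwo B a∉ b∉ a≢b p≢q t t′)
    go _ _ (inj₂ (_ , t)) (inj₂ (_ , t′)) = ⊑-berge χ-sym (⊑-trans s ⊑-swap) (addTwo B a∉ b∉ a≢b (≢-sym p≢q) t t′)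
    go (inj₁ h) _ (inj₁ h′) _ = ⊥-elim (p≢q (φ-inj B (one-a _ h h′)))
    go (inj₁ h) _ _ (inj₁ h′) = ⊥-elim (common _ h h′)
    go _ (inj₁ h) (inj₁ h′) _ = ⊥-elim (common _ h′ h)
    go _ (inj₁ h) _ (inj₁ h′) = ⊥-elim (p≢q (φ-inj B (one-b _ h′ h)))

  fromSmaller : (∀ (U U′ : Tree k) → U ⟶ U′) → ∀ c {T T′ : Tree (2 ℕ.+ k)} → NonStar T → NonStar T′ →
                Berge χ c T ⊎ Berge χ (opp c) T′
  fromSmaller IH c n n′ = Sum.map (addTwoLeaves (twoLeaves n)) (addTwoLeaves (twoLeaves n′))
    (IH _ _ (χ ∘₃ ι) (∘₃-symmetric ι χ-sym) c)

Cover : ∀ {N} → Col N → Colour → Set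
Cover χ c = ∀ x → Covered χ c x ⊎ Covered χ (opp c) x

cover-or-berge : ∀ {k} {U U′ : Tree k} {p p′} → U ⟶ U′ → ∀ χ → Symmetric χ → ∀ c →
                 (Berge χ c (leaf U p) ⊎ Berge χ (opp c) (leaf U′ p′)) ⊎ Cover χ c
cover-or-berge {U = U} {U′} {p} {p′} IH χ χ-sym c = sequence λ v →
  [ (λ B → [ (λ h → inj₂ (inj₂ (_ , h))) , inj₁ ∘ inj₁ ]′ (attach {χ = χ} B p))
  , (λ B → [ (λ h → inj₂ (inj₁ (_ , subst (λ d → Pure χ d _ _) (opp-opp c) h))) , inj₁ ∘ inj₂ ]′
               (attach {χ = χ} B p′)) ]′
  (IH (χ ∘₃ punchIn v) (∘₃-symmetric (punchIn v) χ-sym) c)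

-- Unavoidable patterns on six and seven vertices

Matching : ∀ {N} → Col N → Colour → Set
Matching χ c = ∃₂ λ a b → ∃₂ λ d f → Pure χ c a b × Pure χ c d f × a ≢ d × a ≢ f × b ≢ d × b ≢ f

module _ {N : ℕ} {χ : Col N} (χ-sym : Symmetric χ) {c : Colour} where

  three-covered : 3 ℕ.≤ count (covered χ c) →
    (∃ λ a → ∃₂ λ b d → Pure χ c a b × Pure χ c a d × b ≢ d) ⊎ Matching χ c
  three-covered le with avoidIn {0} (covered χ c) (ℕ.≤-trans (ℕ.s≤s ℕ.z≤n) le) (λ ())
  ... | s , s∈ , _ with covered-true χ c s∈
  ...   | s′ , ss′ with avoidIn (covered χ c) le (lookup (s ∷ s′ ∷ []))
  ...     | t , t∈ , t∉ with covered-true χ c t∈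
  ...       | t′ , tt′ with t′ ≟ s | t′ ≟ s′
  ...         | yes refl | _ = inj₁ (s , s′ , t , ss′ , pure-sym χ-sym tt′ , t∉ (# 1))
  ...         | no _ | yes refl = inj₁ (s′ , s , t , pure-sym χ-sym ss′ , pure-sym χ-sym tt′ , t∉ (# 0))
  ...         | no t′≢s | no t′≢s′ =
    inj₂ (s , s′ , t , t′ , ss′ , tt′ , t∉ (# 0) , ≢-sym t′≢s , t∉ (# 1) , ≢-sym t′≢s′)

  four-covered : 4 ℕ.≤ count (covered χ c) →
    (∃₂ λ a b → ∃₂ λ d f → Pure χ c a b × Pure χ c a d × Pure χ c a f × b ≢ d × b ≢ f × d ≢ f) ⊎ Matching χ c
  four-covered le = [ (λ (_ , _ , _ , ab , ad , b≢d) → widen ab ad b≢d) , inj₂ ]′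
    (three-covered (ℕ.≤-trans (ℕ.n≤1+n 3) le))
    where
    widen : ∀ {a b d} → Pure χ c a b → Pure χ c a d → b ≢ d → _
    widen {a} {b} {d} ab ad b≢d with avoidIn (covered χ c) le (lookup (a ∷ b ∷ d ∷ []))
    ... | u , u∈ , u∉ with covered-true χ c u∈
    ...   | u′ , uu′ with u′ ≟ a | u′ ≟ b | u′ ≟ d
    ...     | yes refl | _ | _ = inj₁ (a , b , d , u , ab , ad , pure-sym χ-sym uu′ , b≢d , u∉ (# 1) , u∉ (# 2))
    ...     | no _ | yes refl | _ =
      inj₂ (a , d , b , u , ad , pure-sym χ-sym uu′ , proj₁ ab , u∉ (# 0) , ≢-sym b≢d , u∉ (# 2))
    ...     | no _ | no _ | yes refl =
      inj₂ (a , b , d , u , ab , pure-sym χ-sym uu′ , proj₁ ad , u∉ (# 0) , b≢d , u∉ (# 1))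
    ...     | no u′≢a | no u′≢b | no _ =
      inj₂ (a , b , u , u′ , ab , uu′ , u∉ (# 0) , ≢-sym u′≢a , u∉ (# 1) , ≢-sym u′≢b)

covered-berge₆ : ∀ {χ : Col 6} → Symmetric χ → ∀ {c} → 3 ℕ.≤ count (covered χ c) →
                 ∀ {T : Tree 5} → NonStar T → Berge χ c T
covered-berge₆ χ-sym le n with toNonStar₅ {1} n
... | Q , q , s = ⊑-berge χ-sym s ([
    (λ (_ , _ , _ , ab , ad , ne) → path₃-berge χ-sym ab ad ne (path₃-nonStar q))
  , (λ (_ , _ , _ , _ , ab , df , h₁ , h₂ , h₃ , h₄) →
       matching₄-berge χ-sym ab df h₁ h₂ h₃ h₄ (matching₄-nonStar₆ q)) ]′
  (three-covered χ-sym le))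

covered-berge₇ : ∀ {χ : Col 7} → Symmetric χ → ∀ {c} → 4 ℕ.≤ count (covered χ c) →
                 ∀ {T : Tree 6} → NonStar T → Berge χ c T
covered-berge₇ χ-sym le n with toNonStar₅ {2} n
... | Q , q , s = ⊑-berge χ-sym s ([
    (λ (_ , _ , _ , _ , ab , ad , af , h₁ , h₂ , h₃) →
       star₄-berge χ-sym ab ad af h₁ h₂ h₃ (star₄-nonStar q))
  , (λ (_ , _ , _ , _ , ab , df , h₁ , h₂ , h₃ , h₄) →
       matching₄-berge χ-sym ab df h₁ h₂ h₃ h₄ (matching₄-nonStar₇ q)) ]′
  (four-covered χ-sym le))

-- The induction

opp-cases : ∀ c d → d ≡ c ⊎ d ≡ opp c
opp-cases c d with d ≟ᶜ c
... | yes e = inj₁ e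
... | no ne = inj₂ (≢→opp ne)

module _ {N : ℕ} {χ : Col N} (χ-sym : Symmetric χ) (2<N : 2 ℕ.< N) {c : Colour} where

  pure-conflict′ : ∀ {x y z} → Pure χ (opp c) x y → Pure χ c x z → ⊥
  pure-conflict′ p q = pure-conflict χ-sym 2<N q p

  sole-atMostOne : ∀ {x y} → Sole χ c x y → AtMostOne χ x
  sole-atMostOne (p , unique) d h h′ with opp-cases c d
  ... | inj₁ refl = trans (unique _ h) (sym (unique _ h′))
  ... | inj₂ refl = ⊥-elim (pure-conflict′ h p)

  covered-opp : Cover χ c → ∀ x → covered χ (opp c) x ≡ uncovered χ c x
  covered-opp cov x with covered? χ c x | covered? χ (opp c) x
  ... | yes (_ , p) | yes (_ , q) = ⊥-elim (pure-conflict′ q p)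
  ... | yes _ | no _ = refl
  ... | no _ | yes _ = refl
  ... | no ¬p | no ¬q = ⊥-elim ([ ¬p , ¬q ]′ (cov x))

-- Vertices with a sole partner are the only obstacle to `noSole-berge`. If both colours have one,
-- two can be removed. If only colour `c` does and the classes have equal size, the other colour
-- contains its tree. Otherwise the class of `c` is strictly larger: two such vertices with
-- different partners are removed, and a common partner leads to `OnePartner`.
larger-side : ∀ {k} {χ : Col (3 ℕ.+ k)} → Symmetric χ → 3 ℕ.< 3 ℕ.+ k → (∀ (U U′ : Tree k) → U ⟶ U′) →
              ∀ c {T T′ : Tree (2 ℕ.+ k)} → NonStar T → NonStar T′ → Cover χ c →
              count (uncovered χ c) ℕ.≤ count (covered χ c) → Berge χ c T ⊎ Berge χ (opp c) T′
larger-side {k} {χ} χ-sym 3<N IH c {T@(leaf _ _)} {T′} n n′ cov le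
  with any? (λ x → any? (sole? χ c x))
... | no none = inj₁ (noSole-berge χ-sym 3<N (λ x y s → none (x , y , s)) le T)
... | yes (d , e , d-sole) with any? (λ x → any? (sole? χ (opp c) x))
...   | yes (x , y , x-sole) = fromSmaller χ-sym d≢x (sole-atMostOne χ-sym 2<N d-sole)
                                 (sole-atMostOne χ-sym 2<N x-sole) common IH c n n′
  where
  2<N = ℕ.s≤s⁻¹ (ℕ.≤-trans 3<N (ℕ.n≤1+n _))
  d≢x : d ≢ x
  d≢x refl = pure-conflict′ χ-sym 2<N (proj₁ x-sole) (proj₁ d-sole)
  common : NoCommon χ d x
  common f h h′ with opp-cases c f
  ... | inj₁ refl = pure-conflict′ χ-sym 2<N (proj₁ x-sole) h′
  ... | inj₂ refl = pure-conflict′ χ-sym 2<N h (proj₁ d-sole)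
...   | no none with count (covered χ c) ℕ.≤? count (uncovered χ c)
...     | yes le′ = inj₂ (noSole-berge χ-sym 3<N (λ x y s → none (x , y , s))
          (≤-subst (count-cong (λ x → sym (trans (cong not (covered-opp χ-sym 2<N cov x)) (not-involutive _))))
                   (count-cong (λ x → sym (covered-opp χ-sym 2<N cov x))) le′) T′)
  where
  2<N = ℕ.s≤s⁻¹ (ℕ.≤-trans 3<N (ℕ.n≤1+n _))
...     | no ¬le′ with any? (λ x → any? (λ y → sole? χ c x y ×-dec ¬? (y ≟ e)))
...       | no none′ = inj₁ (OnePartner.onePartner-berge χ-sym 3<N d-sole all-e n (ℕ.≰⇒> ¬le′))
  where
  all-e : ∀ {x y} → Sole χ c x y → y ≡ e
  all-e {x} {y} s with y ≟ e
  ... | yes eq = eq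
  ... | no ne = ⊥-elim (none′ (x , y , s , ne))
...       | yes (x , y , x-sole , y≢e) = fromSmaller χ-sym d≢x (sole-atMostOne χ-sym 2<N d-sole)
                                           (sole-atMostOne χ-sym 2<N x-sole) common IH c n n′
  where
  2<N = ℕ.s≤s⁻¹ (ℕ.≤-trans 3<N (ℕ.n≤1+n _))
  d≢x : d ≢ x
  d≢x refl = y≢e (proj₂ d-sole y (proj₁ x-sole))
  common : NoCommon χ d x
  common f h h′ with opp-cases c f
  ... | inj₁ refl = y≢e (trans (sym (proj₂ x-sole _ h′)) (proj₂ d-sole _ h))
  ... | inj₂ refl = pure-conflict′ χ-sym 2<N h (proj₁ d-sole)

by-larger-side : ∀ {k} {χ : Col (suc k)} → Symmetric χ → 2 ℕ.< suc k →
  (∀ c {T T′ : Tree k} → NonStar T → NonStar T′ → Cover χ c →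
     count (uncovered χ c) ℕ.≤ count (covered χ c) → Berge χ c T ⊎ Berge χ (opp c) T′) →
  ∀ c {T T′ : Tree k} → NonStar T → NonStar T′ → Cover χ c → Berge χ c T ⊎ Berge χ (opp c) T′
by-larger-side {χ = χ} χ-sym 2<N h c n n′ cov with ℕ.≤-total (count (uncovered χ c)) (count (covered χ c))
... | inj₁ le = h c n n′ cov le
... | inj₂ le = exchange
  (h (opp c) n′ n (λ x → Sum.map id (subst (λ d → Covered χ d x) (sym (opp-opp c))) (Sum.swap (cov x)))
    (≤-subst (count-cong (λ x → sym (trans (cong not (covered-opp χ-sym 2<N cov x)) (not-involutive _))))
             (count-cong (λ x → sym (covered-opp χ-sym 2<N cov x))) le))

half-covered : ∀ {N} (χ : Col N) c m → m ℕ.+ m ℕ.≤ suc N → count (uncovered χ c) ℕ.≤ count (covered χ c) →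
               m ℕ.≤ count (covered χ c)
half-covered χ c m le u≤v = [ id , (λ h → ℕ.≤-trans h u≤v) ]′ (half {m = m} (count-not (covered χ c)) le)

-- Here n = 6 + k. Removing two vertices appeals to all trees on n - 2 vertices, so it starts at n =
-- 8; for n = 6 and n = 7 the larger class has at least three or four vertices and contains one of
-- the computed patterns.
nonStars : ∀ k {T T′ : Tree (5 ℕ.+ k)} → NonStar T → NonStar T′ →
           (∀ {U U′ : Tree (4 ℕ.+ k)} → NonStar U → NonStar U′ → U ⟶ U′) →
           (∀ l → k ≡ 2 ℕ.+ l → ∀ (U U′ : Tree (5 ℕ.+ l)) → U ⟶ U′) → T ⟶ T′
nonStars k {leaf U p} {leaf U′ p′} (more n) (more n′) IH IH₂ χ χ-sym c
  with cover-or-berge {p = p} {p′} (IH n n′) χ χ-sym c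
... | inj₁ B = B
... | inj₂ cov = by-larger-side χ-sym (ℕ.s≤s (ℕ.s≤s (ℕ.s≤s ℕ.z≤n))) (step k χ χ-sym IH₂) c (more n) (more n′) cov
  where
  step : ∀ k (χ : Col (6 ℕ.+ k)) → Symmetric χ → (∀ l → k ≡ 2 ℕ.+ l → ∀ (U U′ : Tree (5 ℕ.+ l)) → U ⟶ U′) →
         ∀ c {T T′ : Tree (5 ℕ.+ k)} → NonStar T → NonStar T′ → Cover χ c →
         count (uncovered χ c) ℕ.≤ count (covered χ c) → Berge χ c T ⊎ Berge χ (opp c) T′
  step 0 χ χ-sym _ c n n′ cov le = inj₁ (covered-berge₆ χ-sym (half-covered χ c 3 (ℕ.n≤1+n _) le) n)
  step 1 χ χ-sym _ c n n′ cov le = inj₁ (covered-berge₇ χ-sym (half-covered χ c 4 ℕ.≤-refl le) n)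
  step (suc (suc l)) χ χ-sym IH₂ c n n′ cov le = larger-side χ-sym (ℕ.m≤m+n 4 _) (IH₂ l refl) c n n′ cov le

-- Beyond six vertices, a star on either side needs only the result for one vertex fewer, whatever
-- the other tree is; two non-stars may also need it for two fewer.
trees : ∀ k (T T′ : Tree (5 ℕ.+ k)) → T ⟶ T′
trees k T T′ with star-or-not T | star-or-not T′
trees zero    T T′ | inj₁ s | inj₁ s′ = ⟶-⊑ s s′ star-star-6
trees zero    T T′ | inj₁ s | inj₂ (_ , more n′ , s′) =
  ⟶-⊑ s s′ (star-step λ χ χ-sym c → base-star χ χ-sym c n′)
trees zero    T T′ | inj₂ (_ , more n , s) | inj₁ s′ =
  ⟶-⊑ s s′ (⟶-swap (star-step λ χ χ-sym c → base-star χ χ-sym c n))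
trees zero    T T′ | inj₂ (_ , n , s) | inj₂ (_ , n′ , s′) =
  ⟶-⊑ s s′ (nonStars zero n n′ (λ m m′ χ χ-sym c → base-nonStar χ χ-sym c m m′) λ _ ())
trees (suc k) T (leaf U′ p′) | inj₁ s | _ = ⟶-⊑ s ⊑-refl (star-step (trees k _ U′))
trees (suc k) (leaf U p) T′ | inj₂ _ | inj₁ s′ = ⟶-⊑ ⊑-refl s′ (⟶-swap (star-step (trees k _ U)))
trees (suc k) T T′ | inj₂ (_ , n , s) | inj₂ (_ , n′ , s′) =
  ⟶-⊑ s s′ (nonStars (suc k) n n′ (λ {U} {U′} _ _ → trees k U U′) (earlier k))
  where
  earlier : ∀ k l → suc k ≡ 2 ℕ.+ l → ∀ (U U′ : Tree (5 ℕ.+ l)) → U ⟶ U′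
  earlier (suc k) l refl = trees k

-- From graphs to grown trees

-- There is at least one edge, and the indexing is such that one further vertex closes the path to a
-- `Cycle` with `k` equal to `len`.
record Path {k} (T : Tree k) (x y : Fin (suc k)) : Set where
  field
    len   : ℕ
    node  : Fin (suc (suc len)) → Fin (suc k)
    inj   : ∀ {i j} → node i ≡ node j → i ≡ j
    first : node zero ≡ x
    last  : node (fromℕ (suc len)) ≡ y
    step  : ∀ i → Joined T (node (inject₁ i)) (node (suc i))

open Path

opposite-inject₁ : ∀ {n} (i : Fin n) → opposite (inject₁ i) ≡ suc (opposite i)
opposite-inject₁ zero    = refl
opposite-inject₁ (suc i) = cong inject₁ (opposite-inject₁ i)

opposite-fromℕ : ∀ n → opposite (fromℕ n) ≡ zero
opposite-fromℕ zero    = refl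
opposite-fromℕ (suc n) = cong inject₁ (opposite-fromℕ n)

reverse : ∀ {k} {T : Tree k} {x y} → Path T x y → Path T y x
reverse {T = T} P = record
  { len = len P ; node = node P ∘ opposite
  ; inj = λ {i} {j} e → trans (sym (opposite-involutive i))
                          (trans (cong opposite (inj P e)) (opposite-involutive j))
  ; first = last P ; last = trans (cong (node P) (opposite-fromℕ (suc (len P)))) (first P)
  ; step = λ i → subst (λ a → Joined T (node P a) (node P (inject₁ (opposite i)))) (sym (opposite-inject₁ i))
                   (Joined-sym (step P (opposite i))) }

path-from-new : ∀ {k} {T : Tree k} {p} → (∀ {x y} → x ≢ y → Path T x y) → ∀ y → Path (leaf T p) zero (suc y)
path-from-new {k} {T} {p} paths y with p ≟ y
... | yes refl = record
  { len = 0 ; node = λ { zero → zero ; (suc zero) → suc p }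
  ; inj = λ { {zero} {zero} _ → refl ; {suc zero} {suc zero} _ → refl ; {zero} {suc zero} () ; {suc zero} {zero} () }
  ; first = refl ; last = refl ; step = λ { zero → Joined-new } }
... | no p≢y = record
  { len = suc (len P) ; node = c ; inj = λ {i} {j} → c-inj i j ; first = refl ; last = cong suc (last P)
  ; step = λ { zero → subst (λ a → Joined (leaf T p) zero (suc a)) (sym (first P)) Joined-new
             ; (suc i) → Joined-leaf (step P i) } }
  where
  P = paths p≢y
  c : Fin (suc (suc (suc (len P)))) → Fin (suc (suc k))
  c zero    = zero
  c (suc i) = suc (node P i)
  c-inj : ∀ i j → c i ≡ c j → i ≡ j
  c-inj zero    zero    _ = refl
  c-inj (suc i) (suc j) e = cong suc (inj P (suc-injective e))

tree-path : ∀ {k} (T : Tree k) {x y} → x ≢ y → Path T x y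
tree-path root       {zero}  {zero}  x≢y = ⊥-elim (x≢y refl)
tree-path (leaf T p) {zero}  {zero}  x≢y = ⊥-elim (x≢y refl)
tree-path (leaf T p) {zero}  {suc y} _   = path-from-new (tree-path T) y
tree-path (leaf T p) {suc x} {zero}  _   = reverse (path-from-new (tree-path T) x)
tree-path (leaf T p) {suc x} {suc y} x≢y = record
  { len = len P ; node = suc ∘ node P ; inj = inj P ∘ suc-injective ; first = cong suc (first P)
  ; last = cong suc (last P) ; step = Joined-leaf ∘ step P }
  where P = tree-path T (x≢y ∘ cong suc)

-- The field induced is where acyclicity of G enters.
record Subtree {m} (G : Graph m) (k : ℕ) : Set where
  field
    T       : Tree k
    σ       : Fin (suc k) → Fin m
    σ-inj   : ∀ {x y} → σ x ≡ σ y → x ≡ y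
    present : ∀ j → Adj G (σ (inject₁ j)) (σ (par T j))
    induced : ∀ {x y} → Adj G (σ x) (σ y) → Joined T x y

open Subtree

module _ {m : ℕ} {G : Graph m} where

  open Graph G renaming (sym to adj-sym; irrefl to adj-irrefl) using ()

  -- The walk is followed until its first step out of the image of `σ`.
  leave : ∀ {k} (σ : Fin (suc k) → Fin m) {u v} → (∀ i → σ i ≢ v) → ∀ i → σ i ≡ u → Star (Adj G) u v →
          ∃₂ λ j w → Adj G (σ j) w × (∀ l → σ l ≢ w)
  leave σ out i e ε = ⊥-elim (out i e)
  leave σ out i refl (_◅_ {j = w} a walk) with any? (λ j → σ j ≟ w)
  ... | yes (j , e) = leave σ out j e walk
  ... | no ne = i , w , a , λ l e → ne (l , e)

  present-joined : ∀ {k} (S : Subtree G k) {x y} → Joined (T S) x y → Adj G (σ S x) (σ S y)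
  present-joined S (j , inj₁ (refl , refl)) = present S j
  present-joined S (j , inj₂ (refl , refl)) = adj-sym (present S j)

  path-cycle : ∀ {k} (S : Subtree G k) {x y w} → Path (T S) x y → (∀ i → σ S i ≢ w) →
               Adj G w (σ S x) → Adj G (σ S y) w → Cycle G
  path-cycle S {w = w} P new wx yw = record
    { k = len P ; c = c ; inj = λ {i} {j} → c-inj i j
    ; step = λ { zero → subst (λ a → Adj G w (σ S a)) (sym (first P)) wx
               ; (suc i) → present-joined S (step P i) }
    ; close = subst (λ a → Adj G (σ S a) w) (sym (last P)) yw }
    where
    c : Fin (suc (suc (suc (len P)))) → Fin m
    c zero    = w
    c (suc i) = σ S (node P i)
    c-inj : ∀ i j → c i ≡ c j → i ≡ j
    c-inj zero    zero    _ = refl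
    c-inj zero    (suc j) e = ⊥-elim (new _ (sym e))
    c-inj (suc i) zero    e = ⊥-elim (new _ e)
    c-inj (suc i) (suc j) e = cong suc (inj P (σ-inj S e))

  grow : ∀ {k} → Connected G → Acyclic G → suc k ℕ.< m → Subtree G k → Subtree G (suc k)
  grow {k} conn acyc lt S with avoid lt (σ S)
  ... | v , v∉ with leave (σ S) v∉ zero refl (conn (σ S zero) v)
  ...   | i , w , iw , w∉ = record
    { T = leaf (T S) i ; σ = σ′ ; σ-inj = λ {x} {y} → σ′-inj x y
    ; present = λ { zero → adj-sym iw ; (suc j) → present S j }
    ; induced = λ {x} {y} → induced′ x y }
    where
    σ′ : Fin (suc (suc k)) → Fin m
    σ′ zero    = w
    σ′ (suc x) = σ S x
    σ′-inj : ∀ x y → σ′ x ≡ σ′ y → x ≡ y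
    σ′-inj zero    zero    _ = refl
    σ′-inj zero    (suc y) e = ⊥-elim (w∉ y (sym e))
    σ′-inj (suc x) zero    e = ⊥-elim (w∉ x e)
    σ′-inj (suc x) (suc y) e = cong suc (σ-inj S e)
    only : ∀ {y} → Adj G w (σ S y) → Joined (leaf (T S) i) zero (suc y)
    only {y} a with i ≟ y
    ... | yes refl = Joined-new
    -- A second neighbour of `w` in the subtree would close the tree path between the two neighbours
    -- to a cycle.
    ... | no i≢y = ⊥-elim (acyc (path-cycle S (tree-path (T S) i≢y) w∉ (adj-sym iw) (adj-sym a)))
    induced′ : ∀ x y → Adj G (σ′ x) (σ′ y) → Joined (leaf (T S) i) x y
    induced′ zero    zero    a = ⊥-elim (adj-irrefl a)
    induced′ zero    (suc y) a = only a
    induced′ (suc x) zero    a = Joined-sym (only (adj-sym a))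
    induced′ (suc x) (suc y) a = Joined-leaf (induced S a)

spanning : ∀ {k} {G : Graph (suc k)} → Connected G → Acyclic G → Subtree G k
spanning {k} {G} conn acyc = go k ℕ.≤-refl
  where
  go : ∀ j → j ℕ.≤ k → Subtree G j
  go zero    _  = record
    { T = root ; σ = λ _ → zero ; σ-inj = λ { {zero} {zero} _ → refl } ; present = λ ()
    ; induced = λ { {zero} {zero} a → ⊥-elim (irrefl G a) } }
  go (suc j) le = grow conn acyc (ℕ.s≤s le) (go j (ℕ.≤-trans (ℕ.n≤1+n j) le))

-- Triples as three-element subsets

insert : ∀ {N} → Fin N → Subset N → Subset N
insert x s = s [ x ]≔ inside

∈-insert : ∀ {N} {x y : Fin N} {s} → x ∈ insert y s → x ≡ y ⊎ x ∈ s
∈-insert {y = zero}  {_ ∷ s} here      = inj₁ refl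
∈-insert {y = zero}  {_ ∷ s} (there h) = inj₂ (there h)
∈-insert {y = suc y} {_ ∷ s} here      = inj₂ here
∈-insert {y = suc y} {_ ∷ s} (there h) = Sum.map (cong suc) there (∈-insert h)

insert-here : ∀ {N} (x : Fin N) s → x ∈ insert x s
insert-here x s = []≔-updates s x

insert-there : ∀ {N} {x : Fin N} y {s} → x ∈ s → x ∈ insert y s
insert-there {x = x} y {s} h with x ≟ y
... | yes refl = insert-here x s
... | no ne = []≔-minimal s x y ne h

∣insert∣ : ∀ {N} (x : Fin N) s → ¬ x ∈ s → ∣ insert x s ∣ ≡ suc ∣ s ∣
∣insert∣ zero    (true ∷ s)  ∉ = ⊥-elim (∉ here)
∣insert∣ zero    (false ∷ s) ∉ = refl
∣insert∣ (suc x) (true ∷ s)  ∉ = cong suc (∣insert∣ x s (∉ ∘ there))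
∣insert∣ (suc x) (false ∷ s) ∉ = ∣insert∣ x s (∉ ∘ there)

insert-comm : ∀ {N} (x y : Fin N) s → insert x (insert y s) ≡ insert y (insert x s)
insert-comm x y s with x ≟ y
... | yes refl = refl
... | no ne = []≔-commutes s y x (≢-sym ne)

set₃ : ∀ {N} → Tri (Fin N) → Subset N
set₃ (x , y , z) = insert x (insert y (insert z ∅))

∈-set₃ : ∀ {N} {w : Fin N} t → w ∈ set₃ t → w ∈₃ t
∈-set₃ t h with ∈-insert h
... | inj₁ e = 1st e
... | inj₂ h′ with ∈-insert h′
...   | inj₁ e = 2nd e
...   | inj₂ h″ with ∈-insert h″
...     | inj₁ e = 3rd e
...     | inj₂ h‴ = ⊥-elim (∉⊥ h‴)

set₃-∈ : ∀ {N} {w : Fin N} t → w ∈₃ t → w ∈ set₃ t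
set₃-∈ (x , y , z) (1st refl) = insert-here x _
set₃-∈ (x , y , z) (2nd refl) = insert-there x (insert-here y _)
set₃-∈ (x , y , z) (3rd refl) = insert-there x (insert-there y (insert-here z _))

set₃-injective : ∀ {N} (s t : Tri (Fin N)) → set₃ s ≡ set₃ t → s ≈₃ t
set₃-injective s t e = sub s t e , sub t s (sym e)
  where
  sub : ∀ s t → set₃ s ≡ set₃ t → s ⊆₃ t
  sub s t e = mem (1st refl) , mem (2nd refl) , mem (3rd refl)
    where
    mem : ∀ {w} → w ∈₃ s → w ∈₃ t
    mem h = ∈-set₃ t (subst (_ ∈_) e (set₃-∈ s h))

∣set₃∣ : ∀ {N} {x y z : Fin N} → x ≢ y → z ≢ x → z ≢ y → ∣ set₃ (x , y , z) ∣ ≡ 3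
∣set₃∣ {N} {x} {y} {z} xy zx zy =
  trans (∣insert∣ x _ ([ xy , (λ h → [ zx ∘ sym , ∉⊥ ]′ (∈-insert h)) ]′ ∘ ∈-insert))
    (cong suc (trans (∣insert∣ y _ ([ zy ∘ sym , ∉⊥ ]′ ∘ ∈-insert))
      (cong suc (trans (∣insert∣ z _ ∉⊥) (cong suc (∣⊥∣≡0 N))))))

vertexColouring : ∀ {N} → Colouring N → Col N
vertexColouring χ x y z = χ (set₃ (x , y , z))

vertexColouring-symmetric : ∀ {N} (χ : Colouring N) → Symmetric (vertexColouring χ)
vertexColouring-symmetric χ = record
  { swap₁ = λ x y z → cong χ (insert-comm x y _)
  ; swap₂ = λ x y z → cong (χ ∘ insert x) (insert-comm y z _) }

toBergeIn : ∀ {N k} {G : Graph (suc k)} (χ : Colouring N) c (S : Subtree G k) →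
            Berge (vertexColouring χ) c (T S) → BergeIn χ c G
toBergeIn {N} {k} {G} χ c S B = φ B ∘ τ , (λ e → τ-inj (φ-inj B e)) , f , hyper , contains , f-inj
  where
  τ : Fin (suc k) → Fin (suc k)
  τ x = proj₁ (injective⇒surjective (σ S) (σ-inj S) x)
  σ∘τ : ∀ x → σ S (τ x) ≡ x
  σ∘τ x = proj₂ (injective⇒surjective (σ S) (σ-inj S) x)
  τ-inj : ∀ {x y} → τ x ≡ τ y → x ≡ y
  τ-inj {x} {y} e = trans (sym (σ∘τ x)) (trans (cong (σ S) e) (σ∘τ y))
  edge : (e : Edge G) → Joined (T S) (τ (proj₁ (proj₁ e))) (τ (proj₂ (proj₁ e)))
  edge ((x , y) , _ , a) = induced S (subst₂ (Adj G) (sym (σ∘τ x)) (sym (σ∘τ y)) a)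
  f : Edge G → Subset N
  f e = set₃ (tri B (proj₁ (edge e)))
  hyper : ∀ e → HyperedgeOf χ c (f e)
  hyper e = let j = proj₁ (edge e) in
    ∣set₃∣ (inject₁≢par (T S) j ∘ φ-inj B) (third≢child B j) (third≢parent B j) , colour B j
  ends : ∀ {j x y} → Join (T S) j x y → φ B x ∈₃ tri B j × φ B y ∈₃ tri B j
  ends (inj₁ (refl , refl)) = 1st refl , 2nd refl
  ends (inj₂ (refl , refl)) = 2nd refl , 1st refl
  contains : ∀ e → (φ B (τ (proj₁ (proj₁ e))) ∈ f e) × (φ B (τ (proj₂ (proj₁ e))) ∈ f e)
  contains e = let j , J = edge e in set₃-∈ (tri B j) (proj₁ (ends J)) , set₃-∈ (tri B j) (proj₂ (ends J))
  -- The order of the ends in `Edge` prevents one tree edge from coming from two oppositely directed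
  -- pairs.
  same : ∀ {j x y x′ y′} → Join (T S) j (τ x) (τ y) → Join (T S) j (τ x′) (τ y′) → x Fin.< y → x′ Fin.< y′ →
         (x , y) ≡ (x′ , y′)
  same (inj₁ (a , b)) (inj₁ (a′ , b′)) _ _ = cong₂ _,_ (τ-inj (trans a (sym a′))) (τ-inj (trans b (sym b′)))
  same (inj₂ (a , b)) (inj₂ (a′ , b′)) _ _ = cong₂ _,_ (τ-inj (trans b (sym b′))) (τ-inj (trans a (sym a′)))
  same (inj₁ (a , b)) (inj₂ (a′ , b′)) lt lt′ with τ-inj (trans a (sym a′)) | τ-inj (trans b (sym b′))
  ... | refl | refl = ⊥-elim (ℕ.<-asym lt lt′)
  same (inj₂ (a , b)) (inj₁ (a′ , b′)) lt lt′ with τ-inj (trans a (sym a′)) | τ-inj (trans b (sym b′))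
  ... | refl | refl = ⊥-elim (ℕ.<-asym lt lt′)
  f-inj : ∀ e e′ → f e ≡ f e′ → proj₁ e ≡ proj₁ e′
  f-inj e e′ eq = same (proj₂ (edge e))
    (subst (λ j → Join (T S) j _ _)
      (sym (distinct B (set₃-injective (tri B (proj₁ (edge e))) (tri B (proj₁ (edge e′))) eq)))
      (proj₂ (edge e′)))
    (proj₁ (proj₂ e)) (proj₁ (proj₂ e′))

-- The Ramsey number

-- A smaller second tree is enlarged to n vertices by leaves, because `trees` compares trees of
-- equal size; `unpad` discards them from the copy found.
pad : ∀ d {k} → Tree k → Tree (d ℕ.+ k)
pad zero    T = T
pad (suc d) T = leaf (pad d T) zero

unpad : ∀ d {k N} {χ : Col N} {c} {T : Tree k} → Berge χ c (pad d T) → Berge χ c T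
unpad zero    B = B
unpad (suc d) B = unpad d (forgetLeaf B)

ramsey-upper : ∀ {k l} {T₁ : Graph (6 ℕ.+ k)} {T₂ : Graph (suc l)} → IsTree T₁ → IsTree T₂ → l ℕ.≤ 5 ℕ.+ k →
               RamseyProp T₁ T₂ (6 ℕ.+ k)
ramsey-upper {k} {l} (_ , conn₁ , acyc₁) (_ , conn₂ , acyc₂) le χ =
  Sum.map (toBergeIn χ blue S₁) (λ B → toBergeIn χ red S₂ (unpad d (un eq B)))
    (trees k (T S₁) (subst Tree eq (pad d (T S₂))) (vertexColouring χ) (vertexColouring-symmetric χ) blue)
  where
  S₁ = spanning conn₁ acyc₁
  S₂ = spanning conn₂ acyc₂
  d = 5 ℕ.+ k ℕ.∸ l
  eq : d ℕ.+ l ≡ 5 ℕ.+ k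
  eq = ℕ.m∸n+n≡m le
  un : ∀ {a b} {U : Tree a} {c} (e : a ≡ b) → Berge (vertexColouring χ) c (subst Tree e U) →
       Berge (vertexColouring χ) c U
  un refl B = B

has-edge : ∀ {m} {G : Graph m} → Connected G → m ≥ 2 → Edge G
has-edge {suc zero} _ (ℕ.s≤s ())
has-edge {suc (suc m)} {G} conn _ with conn zero (suc zero)
... | _◅_ {j = y} a _ with ℕ.<-cmp (toℕ {suc (suc m)} zero) (toℕ y)
...   | tri< lt _ _ = (zero , y) , lt , a
...   | tri≈ _ e _ with toℕ-injective {suc (suc m)} {zero} {y} e
...     | refl = ⊥-elim (irrefl G a)
has-edge {suc (suc m)} {G} conn _ | _◅_ {j = y} a _ | tri> _ _ ()

-- If every hyperedge is blue, a blue copy of `T₁` needs n vertices, and a red copy of `T₂` needs a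
-- red hyperedge for an edge, which exists since m ≥ 2.
ramsey-lower : ∀ {n m} {T₁ : Graph n} {T₂ : Graph m} → IsTree T₂ → m ≥ 2 → ∀ N → N ℕ.< n → ¬ RamseyProp T₁ T₂ N
ramsey-lower {T₂ = T₂} (_ , conn₂ , _) m≥2 N N<n ramsey with ramsey (λ _ → blue)
... | inj₁ (φ , φ-inj , _) = ℕ.<⇒≱ N<n (injective⇒≤ {f = φ} φ-inj)
... | inj₂ (_ , _ , _ , hyper , _) = case proj₂ (hyper (has-edge {G = T₂} conn₂ m≥2)) of λ ()

theorem21 : ∀ (n m : ℕ) (T₁ : Graph n) (T₂ : Graph m) → IsTree T₁ → IsTree T₂ →
    m ≥ 2 → 6 ≤ n → m ≤ n → BergeRamseyIs T₁ T₂ n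
theorem21 (suc (suc (suc (suc (suc (suc k)))))) (suc l) T₁ T₂ tree₁ tree₂ m≥2
          (ℕ.s≤s (ℕ.s≤s (ℕ.s≤s (ℕ.s≤s (ℕ.s≤s (ℕ.s≤s _)))))) (ℕ.s≤s le) =
  ramsey-upper {T₁ = T₁} {T₂} tree₁ tree₂ le , ramsey-lower {T₁ = T₁} {T₂} tree₂ m≥2
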